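{- Let $G=(V,E)$ be an unweighted, undirected (multi-)graph. In general, a greedy tree-packing $\mathcal T$ needs $|\mathcal T|=\Omega(\lambda/\varepsilon^{3/2})$ trees to satisfy $$|\ell^{\mathcal T}(e)-\ell^*(e)|\le\varepsilon/\lambda$$ for all $e\in E$, whenever $\varepsilon^{ -1}=O(n^{1/3})$.
   Context: Here $n=|V|$ is the number of vertices of $G$, and $\lambda$ is the min-cut value of $G$, i.e. the minimum number of edges whose deletion causes the graph to become disconnected. A tree-packing $\mathcal T$ of $G$ is a family of spanning trees of $G$, where edges can appear in multiple trees. The load $L^{\mathcal T}(e)$ of an edge $e$ is the number of trees of $\mathcal T$ that contain $e$, and the relative load is $\ell^{\mathcal T}(e)=L^{\mathcal T}(e)/|\mathcal T|$. A tree-packing is greedy if its spanning trees form successive minimum weight spanning trees, where the weight of an edge is the number of trees (packed so far) that the edge belongs to. For a partition $\mathcal P$ of the vertex set $V$, $G/\mathcal P$ is the graph obtained from $G$ by contracting each class of $\mathcal P$ to a vertex, and $E(G/\mathcal P)$ is the set of edges of $G$ whose endpoints lie in different classes. The partition value is $\mathrm{part\_val}(\mathcal P)=\frac{|E(G/\mathcal P)|}{|\mathcal P|-1}$, and $\Phi_G=\min_{\mathcal P}\mathrm{part\_val}(\mathcal P)$. The ideal relative loads $\ell^*(e)$ are defined recursively: (1) let $\mathcal P^*$ be a partition of $V$ with $\mathrm{part\_val}(\mathcal P^*)=\Phi_G$; (2) for all $e\in E(G/\mathcal P^*)$, set $\ell^*(e)=1/\Phi_G$; (3) for each $S\in\mathcal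 P^*$, recurse on the induced subgraph $G[S]$. -}

module Defs where

open import Algebra.Properties.CommutativeMonoid.Sum using (sum)
open import Data.Bool using (if_then_else_)
open import Data.Fin using (Fin; _≟_)
open import Data.Fin.Subset using (Subset; _∈_; ∁; ∣_∣) renaming (⊤ to full)
open import Data.Fin.Subset.Properties using (_∈?_)
open import Data.Integer using (+_)
open import Data.List using (List; []; _∷_)
open import Data.List.Relation.Unary.Unique.Propositional using (Unique)
open import Data.Nat using (ℕ; zero; suc; _≤_)
import Data.Nat.Base as ℕ
open import Data.Nat.Properties using (+-0-commutativeMonoid)
open import Data.Product using (Σ-syntax; ∃-syntax; _×_; _,_)
open import Data.Rational as ℚ using (ℚ; _/_; 1/_; 1ℚ; _-_; _*_)
open import Data.Sum using (_⊎_)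
open import Data.Vec using (Vec; []; _∷_; lookup; tabulate; count)
open import Relation.Binary.PropositionalEquality using (_≡_; _≢_)
open import Relation.Nullary using (¬_; Dec; does; ¬?; _×-dec_)

-- Parallel edges are distinct elements of Fin m; the order of the two
-- endpoints of an edge carries no information.
record MultiGraph (n : ℕ) : Set where
  field
    m        : ℕ
    src tgt  : Fin m → Fin n
    loopless : ∀ e → src e ≢ tgt e

module _ {n : ℕ} (G : MultiGraph n) where
  open MultiGraph G

  Joins : Fin m → Fin n → Fin n → Set
  Joins e u v = (src e ≡ u × tgt e ≡ v) ⊎ (src e ≡ v × tgt e ≡ u)

  data Walk (A : Subset m) : Fin n → Fin n → Set where
    nil  : ∀ {v} → Walk A v v
    step : ∀ {u v w} (e : Fin m) → e ∈ A → Joins e u v → Walk A v w → Walk A u w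

  walkEdges : ∀ {A u v} → Walk A u v → List (Fin m)
  walkEdges nil            = []
  walkEdges (step e _ _ p) = e ∷ walkEdges p

  -- The final vertex is omitted, so that a cycle has no repetitions here.
  walkVertices : ∀ {A u v} → Walk A u v → List (Fin n)
  walkVertices nil                = []
  walkVertices (step {u} _ _ _ p) = u ∷ walkVertices p

  IsCycle : ∀ {A v} → Walk A v v → Set
  IsCycle p = walkEdges p ≢ [] × Unique (walkEdges p) × Unique (walkVertices p)

  Connected : Subset m → Set
  Connected A = ∀ u v → Walk A u v

  Acyclic : Subset m → Set
  Acyclic A = ∀ {v} (p : Walk A v v) → ¬ IsCycle p

  IsSpanningTree : Subset m → Set
  IsSpanningTree T = Connected T × Acyclic T

  IsMinCutValue : ℕ → Set
  IsMinCutValue k =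
    (∃[ F ] ∣ F ∣ ≡ k × ¬ Connected (∁ F)) ×
    (∀ F → ¬ Connected (∁ F) → k ≤ ∣ F ∣)

  weight : (Fin m → ℕ) → Subset m → ℕ
  weight w T = sum +-0-commutativeMonoid (λ e → if lookup T e then w e else 0)

  IsMinSpanningTree : (Fin m → ℕ) → Subset m → Set
  IsMinSpanningTree w T =
    IsSpanningTree T × (∀ T′ → IsSpanningTree T′ → weight w T ≤ weight w T′)

  load : ∀ {τ} → Vec (Subset m) τ → Fin m → ℕ
  load 𝒯 e = count (e ∈?_) 𝒯

  relativeLoad : ∀ {τ} .{{_ : ℕ.NonZero τ}} → Vec (Subset m) τ → Fin m → ℚ
  relativeLoad {τ} 𝒯 e = + load 𝒯 e / τ

  -- The most recently packed tree is the head.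
  data IsGreedy : ∀ {τ} → Vec (Subset m) τ → Set where
    []  : IsGreedy []
    _∷_ : ∀ {τ T} {𝒯 : Vec (Subset m) τ} →
          IsMinSpanningTree (load 𝒯) T → IsGreedy 𝒯 → IsGreedy (T ∷ 𝒯)

  -- A partition of S into 1 + r ≥ 2 nonempty classes; the values of
  -- class outside S are irrelevant.
  record Partition (S : Subset n) : Set where
    field
      r           : ℕ
      {{r-nonZero}} : ℕ.NonZero r
      class       : Fin n → Fin (suc r)
      inhabited   : ∀ i → ∃[ v ] v ∈ S × class v ≡ i

    classSet : Fin (suc r) → Subset n
    classSet i = tabulate λ v → does (v ∈? S ×-dec class v ≟ i)

    Crosses : Fin m → Set
    Crosses e = src e ∈ S × tgt e ∈ S × class (src e) ≢ class (tgt e)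

    crosses? : ∀ e → Dec (Crosses e)
    crosses? e = src e ∈? S ×-dec tgt e ∈? S ×-dec ¬? (class (src e) ≟ class (tgt e))

    crossing : Subset m
    crossing = tabulate λ e → does (crosses? e)

    value : ℚ
    value = + ∣ crossing ∣ / r

  open Partition

  IsMinPartition : ∀ {S} → Partition S → Set
  IsMinPartition {S} P = ∀ (P′ : Partition S) → value P ℚ.≤ value P′

  -- ℓ is obtained on the edges of G[S] by the recursion, for some choice
  -- of minimum partitions; it stops at single vertices.
  data IdealOn (ℓ : Fin m → ℚ) : Subset n → Set where
    single : ∀ {S} → ∣ S ∣ ≡ 1 → IdealOn ℓ S
    split  : ∀ {S} (P : Partition S) → IsMinPartition P →
             .{{_ : ℚ.NonZero (value P)}} →
             (∀ e → Crosses P e → ℓ e ≡ 1/ value P) →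
             (∀ i → IdealOn ℓ (classSet P i)) →
             IdealOn ℓ S

  IsIdealLoad : (Fin m → ℚ) → Set
  IsIdealLoad ℓ = IdealOn ℓ full

  ApproximatesWithin : ∀ {τ} .{{_ : ℕ.NonZero τ}} →
                       ℚ → Vec (Subset m) τ → (Fin m → ℚ) → Set
  ApproximatesWithin δ 𝒯 ℓ = ∀ e → ℚ.∣ relativeLoad 𝒯 e - ℓ e ∣ ℚ.≤ δ

firstTrees : ∀ {A : Set} → (ℕ → A) → (τ : ℕ) → Vec A τ
firstTrees T zero    = []
firstTrees T (suc τ) = T τ ∷ firstTrees T τ

fromℕ : ℕ → ℚ
fromℕ k = + k / 1

square cube : ℚ → ℚ
square x = x * x
cube   x = x * x * x

-- 1/ε ≤ K n^(1/3), cubed, for ε > 0.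
InverseAtMostCubeRoot : (K ε : ℚ) (n : ℕ) → Set
InverseAtMostCubeRoot K ε n = 1ℚ ℚ.≤ cube (K * ε) * fromℕ n

-- τ ≥ c k / ε^(3/2), squared, for c, ε > 0.
AtLeastOverThreeHalves : (c : ℚ) (k : ℕ) (ε : ℚ) (τ : ℕ) → Set
AtLeastOverThreeHalves c k ε τ =
  square (c * fromℕ k) ℚ.≤ square (fromℕ τ) * cube ε

{-# OPTIONS --safe #-}
module Submission where

-- The graph is a fan: a hub, vertices y₀, …, yₖ₋₁ with a spoke from yᵢ to the hub
-- and a rim edge from yᵢ to yᵢ₋₁ (to the hub for i = 0), and at least one leaf at
-- the hub, all edges with multiplicity λ₀.  A leaf gives the minimum cut λ₀; the
-- ideal loads are 1/λ₀ at the leaves and 1/(2λ₀) in the fan.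
--
-- A spanning tree of the fan normally uses one of the two edges of each yᵢ.  But
-- when consecutive yₗ, …, yₚ have the same load on both of their edges, it is
-- also of minimum weight to use none of the edges of yₗ and both edges of yₚ.
-- Breaking ties in this way keeps the total loads of the yᵢ nondecreasing in i,
-- and as in chip firing it continues until they are strictly increasing.  So
-- after q rounds the totals of y₀ and yₖ₋₁ differ by at least k - 1 or by a
-- multiple of q / k².  With k of order ε^(-1/2) the second alternative exceeds
-- the permitted deviation, and the first one forces τ ≥ (k - 1) λ₀ / (4 ε).
-- If ε is bounded below, the load of a leaf edge suffices.

open import Defs
import Data.Nat.Properties
open import Algebra.Properties.CommutativeMonoid.Sum Data.Nat.Properties.+-0-commutativeMonoid
  using (sum; sum-cong-≗; ∑-distrib-+; ∑-comm; sum-replicate-zero)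
open import Data.Bool using (Bool; true; false; if_then_else_; _∧_; _∨_; not)
open import Data.Fin as Fin
  using (Fin; zero; suc; toℕ; fromℕ<; inject₁; punchIn; punchOut; _↑ˡ_; _↑ʳ_; splitAt; join; combine; remQuot)
open import Data.Fin.Properties as Fin
  using (toℕ-fromℕ<; toℕ<n; toℕ-↑ˡ; toℕ-↑ʳ; toℕ-inject₁; toℕ-injective; punchOut-cong; punchOut-punchIn;
         punchInᵢ≢i; remQuot-combine; splitAt-join; splitAt-↑ˡ; splitAt-↑ʳ; splitAt⁻¹-↑ˡ; splitAt⁻¹-↑ʳ; any?)
open import Data.Fin.Subset using (Subset; _∈_; _∉_; ∣_∣; _-_; ∁; ⁅_⁆) renaming (⊤ to full)
open import Data.Fin.Subset.Properties
  using (_∈?_; ∈⊤; ⊆-antisym; x∈p∧x≢y⇒x∈p-y; x∈p⇒∣p-x∣<∣p∣; x∉p⇒x∈∁p; x∈∁p⇒x∉p; x∈⁅x⁆; x∈⁅y⁆⇒x≡y; ∣⁅x⁆∣≡1)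
open import Data.Integer as ℤ using (1ℤ; -[1+_]) renaming (+_ to pos)
import Data.Integer.Properties as ℤ
open import Data.List using (_∷_)
open import Data.List.Relation.Unary.All using (All; []; _∷_)
open import Data.List.Relation.Unary.AllPairs using (_∷_)
open import Data.Nat hiding (∣_-_∣; _/_)
open import Data.Nat.Properties
open import Data.Nat.Solver using (module +-*-Solver)
open +-*-Solver using (solve; _:+_; _:*_; _:=_; con)
open import Data.Product using (Σ-syntax; ∃-syntax; _×_; _,_; proj₁; proj₂)
open import Data.Rational as ℚ using (ℚ; mkℚ; _/_; 1/_; 0ℚ; 1ℚ; toℚᵘ)
import Data.Rational.Properties as ℚ
import Data.Rational.Solver
open import Data.Rational.Unnormalised as ℚᵘ using (mkℚᵘ; *≤*; *≡*; _≃_)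
import Data.Rational.Unnormalised.Properties as ℚᵘ
open import Data.Sum as Sum using (_⊎_; inj₁; inj₂; swap; [_,_]′)
open import Data.Vec using ([]; _∷_; tabulate; lookup)
open import Data.Vec.Properties using (lookup⇒[]=; []=⇒lookup; lookup∘tabulate)
open import Function using (_∘_; id)
open import Relation.Binary.Definitions using (Tri; tri<; tri≈; tri>)
open import Relation.Binary.PropositionalEquality
open import Relation.Nullary using (¬_; Dec; yes; no; does; contradiction; _×-dec_)
open import Relation.Nullary.Decidable using (dec-true; dec-false)
open import Relation.Unary using (Decidable)

module ℚS = Data.Rational.Solver.+-*-Solver

-- Every tree has to be certified as minimum against all spanning trees. The certificate is a
-- potential: each load is replaced by the smaller load `height` at the upper endpoint of its edge.
-- Heights are nondecreasing in i, so counting the edges of a spanning tree in each final segment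
-- bounds its weight from below by the sum of the heights. The chosen tree attains this bound
-- because links join equal heights. Parallel edges only rescale time. One tree of the simple fan is
-- repeated in all λ₀ copies before the next one is formed, so τ trees amount to about τ / λ₀
-- rounds. An incomplete round is handled by comparing the most advanced copy at the top with the
-- least advanced copy at the bottom. The size of k balances two demands. Since q is about τ / λ₀, a
-- gap of order q / k² in the loads is one of order 1 / (k² λ₀) in the relative loads; it must
-- exceed a constant times ε / λ₀, which keeps k² below a multiple of 1 / ε. The bound from the
-- other alternative improves with k, so k is taken maximal. The remaining vertices become leaves,
-- which makes n arbitrary once the fan fits.

private
  variable
    m n ρ : ℕ


-- Finite sums, indicator counts and merging of colours

Σᶠ : (Fin m → ℕ) → ℕ
Σᶠ = sum

⟦_⟧ : Bool → ℕ
⟦ b ⟧ = if b then 1 else 0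

Σᶠ-mono : {f g : Fin m → ℕ} → (∀ i → f i ≤ g i) → Σᶠ f ≤ Σᶠ g
Σᶠ-mono {zero}  f≤g = z≤n
Σᶠ-mono {suc m} f≤g = +-mono-≤ (f≤g zero) (Σᶠ-mono (f≤g ∘ suc))

Σᶠ-const : ∀ m c → Σᶠ {m} (λ _ → c) ≡ m * c
Σᶠ-const zero    c = refl
Σᶠ-const (suc m) c = cong (c +_) (Σᶠ-const m c)

Σᶠ-*ˡ : ∀ c (f : Fin m → ℕ) → Σᶠ (λ i → c * f i) ≡ c * Σᶠ f
Σᶠ-*ˡ {zero}  c f = sym (*-zeroʳ c)
Σᶠ-*ˡ {suc m} c f = trans (cong (c * f zero +_) (Σᶠ-*ˡ c (f ∘ suc))) (sym (*-distribˡ-+ c _ _))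

Σᶠ-zero : {f : Fin m → ℕ} → (∀ i → f i ≡ 0) → Σᶠ f ≡ 0
Σᶠ-zero {m} f≡0 = trans (sum-cong-≗ f≡0) (sum-replicate-zero m)

term≤Σᶠ : (f : Fin m → ℕ) → ∀ i → f i ≤ Σᶠ f
term≤Σᶠ f zero    = m≤m+n _ _
term≤Σᶠ f (suc i) = ≤-trans (term≤Σᶠ (f ∘ suc) i) (m≤n+m _ (f zero))

∣∣≡Σᶠ : (A : Subset m) → ∣ A ∣ ≡ Σᶠ (λ e → ⟦ lookup A e ⟧)
∣∣≡Σᶠ []          = refl
∣∣≡Σᶠ (true  ∷ A) = cong suc (∣∣≡Σᶠ A)
∣∣≡Σᶠ (false ∷ A) = ∣∣≡Σᶠ A

∈⇒1≤ : {A : Subset m} {e : Fin m} → e ∈ A → 1 ≤ ⟦ lookup A e ⟧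
∈⇒1≤ e∈A = ≤-reflexive (cong ⟦_⟧ (sym ([]=⇒lookup e∈A)))

does-∈? : (A : Subset m) → ∀ e → does (e ∈? A) ≡ lookup A e
does-∈? A e with lookup A e in eq
... | true  = dec-true (e ∈? A) (lookup⇒[]= e A eq)
... | false = dec-false (e ∈? A) λ e∈A → contradiction (trans (sym eq) ([]=⇒lookup e∈A)) λ ()

without : (Fin m → ℕ) → Fin m → Fin m → ℕ
without χ zero    zero    = 0
without χ zero    (suc i) = χ (suc i)
without χ (suc e) zero    = χ zero
without χ (suc e) (suc i) = without (χ ∘ suc) e i

without-≢ : (χ : Fin m → ℕ) → ∀ {e i} → e ≢ i → without χ e i ≡ χ i
without-≢ χ {zero}  {zero}  e≢i = contradiction refl e≢i
without-≢ χ {zero}  {suc i} e≢i = refl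
without-≢ χ {suc e} {zero}  e≢i = refl
without-≢ χ {suc e} {suc i} e≢i = without-≢ (χ ∘ suc) (e≢i ∘ cong suc)

Σᶠ-without : (χ : Fin m → ℕ) → ∀ e → χ e + Σᶠ (without χ e) ≡ Σᶠ χ
Σᶠ-without χ zero    = refl
Σᶠ-without χ (suc e) = begin
  χ (suc e) + (χ zero + Σᶠ (without (χ ∘ suc) e)) ≡⟨ +-assoc (χ (suc e)) _ _ ⟨
  χ (suc e) + χ zero + Σᶠ (without (χ ∘ suc) e)   ≡⟨ cong (_+ Σᶠ (without (χ ∘ suc) e)) (+-comm (χ (suc e)) _) ⟩
  χ zero + χ (suc e) + Σᶠ (without (χ ∘ suc) e)   ≡⟨ +-assoc (χ zero) _ _ ⟩
  χ zero + (χ (suc e) + Σᶠ (without (χ ∘ suc) e)) ≡⟨ cong (χ zero +_) (Σᶠ-without (χ ∘ suc) e) ⟩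
  χ zero + Σᶠ (χ ∘ suc)                           ∎
  where open ≡-Reasoning

-- Contraction of an edge whose ends have colours `c` and `d`: it costs exactly one colour.
merge : {c d : Fin (suc (suc ρ))} → c ≢ d → Fin (suc (suc ρ)) → Fin (suc ρ)
merge {c = c} c≢d x with c Fin.≟ x
... | yes _   = punchOut c≢d
... | no  c≢x = punchOut c≢x

merge-identifies : {c d : Fin (suc (suc ρ))} (c≢d : c ≢ d) → merge c≢d c ≡ merge c≢d d
merge-identifies {c = c} {d} c≢d with c Fin.≟ c | c Fin.≟ d
... | no c≢c | _       = contradiction refl c≢c
... | yes _  | yes c≡d = contradiction c≡d c≢d
... | yes _  | no _    = punchOut-cong c refl

merge-punchIn : {c d : Fin (suc (suc ρ))} (c≢d : c ≢ d) → ∀ y → merge c≢d (punchIn c y) ≡ y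
merge-punchIn {c = c} c≢d y with c Fin.≟ punchIn c y
... | yes c≡ = contradiction (sym c≡) (punchInᵢ≢i c y)
... | no  c≢ = trans (punchOut-cong c refl) (punchOut-punchIn c)

-- Walks, contraction and acyclicity

module Walks {n : ℕ} (G : MultiGraph n) where
  open MultiGraph G renaming (m to edges)

  infixr 5 _◅◅_

  _◅◅_ : ∀ {A u v w} → Walk G A u v → Walk G A v w → Walk G A u w
  nil          ◅◅ q = q
  step e i j p ◅◅ q = step e i j (p ◅◅ q)

  reverse : ∀ {A u v} → Walk G A u v → Walk G A v u
  reverse nil            = nil
  reverse (step e i j p) = reverse p ◅◅ step e i (swap j) nil

  edgeWalk : ∀ {A u v} e → e ∈ A → Joins G e u v → Walk G A u v
  edgeWalk e i j = step e i j nil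

  connectedVia : ∀ {A} root → (∀ v → Walk G A v root) → Connected G A
  connectedVia root to u v = to u ◅◅ reverse (to v)

  walk-map : ∀ {A B u v} → (∀ e {u v} → e ∈ A → Joins G e u v → Walk G B u v) →
             Walk G A u v → Walk G B u v
  walk-map f nil            = nil
  walk-map f (step e i j p) = f e i j ◅◅ walk-map f p

  crossingEdge : ∀ {A u v} {C : Set} → (∀ (x y : C) → Dec (x ≡ y)) → (κ : Fin n → C) →
                 Walk G A u v → κ u ≢ κ v → ∃[ e ] e ∈ A × κ (src e) ≢ κ (tgt e)
  crossingEdge _≟_ κ nil κu≢κv = contradiction refl κu≢κv
  crossingEdge _≟_ κ (step {u} {v} e i j p) κu≢κw with κ u ≟ κ v | j
  ... | yes κu≡κv | _                    = crossingEdge _≟_ κ p (κu≢κw ∘ trans κu≡κv)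
  ... | no  κu≢κv | inj₁ (refl , refl) = e , i , κu≢κv
  ... | no  κu≢κv | inj₂ (refl , refl) = e , i , κu≢κv ∘ sym

  -- Induction on the number of colours: a walk between two colours contains a crossing edge `e`,
  -- whose end colours are merged. After that `e` no longer crosses, so its weight may be set to 0
  -- while `A` stays the same. The weights `χ` make the bound usable for counting whole edge sets,
  -- final segments of the index range, or a single kind of edge.
  crossing-bound : ∀ {A} → Connected G A → (κ : Fin n → Fin (suc ρ)) →
                   (∀ i → ∃[ v ] κ v ≡ i) → (χ : Fin edges → ℕ) →
                   (∀ e → e ∈ A → κ (src e) ≢ κ (tgt e) → 1 ≤ χ e) → ρ ≤ Σᶠ χ
  crossing-bound {zero} conn κ onto χ χ≥1 = z≤n
  crossing-bound {suc ρ} conn κ onto χ χ≥1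
    with crossingEdge Fin._≟_ κ (conn (proj₁ (onto zero)) (proj₁ (onto (suc zero))))
           (λ eq → contradiction (trans (sym (proj₂ (onto zero))) (trans eq (proj₂ (onto (suc zero))))) λ ())
  ... | e , e∈A , c≢d = begin
    1 + ρ                       ≤⟨ +-mono-≤ (χ≥1 e e∈A c≢d) rest ⟩
    χ e + Σᶠ (without χ e)      ≡⟨ Σᶠ-without χ e ⟩
    Σᶠ χ                        ∎
    where
    open ≤-Reasoning
    rest : ρ ≤ Σᶠ (without χ e)
    rest = crossing-bound conn (merge c≢d ∘ κ)
      (λ i → let v , κv≡ = onto (punchIn (κ (src e)) i) in
             v , trans (cong (merge c≢d) κv≡) (merge-punchIn c≢d i))
      (without χ e)
      (λ e′ e′∈A ≢ → subst (1 ≤_)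
        (sym (without-≢ χ {e} λ { refl → ≢ (merge-identifies c≢d) }))
        (χ≥1 e′ e′∈A (≢ ∘ cong (merge c≢d))))

  avoid : ∀ {A u v} e (p : Walk G A u v) → All (e ≢_) (walkEdges G p) → Walk G (A - e) u v
  avoid e nil            []         = nil
  avoid e (step f i j p) (e≢f ∷ ps) =
    step f (x∈p∧x≢y⇒x∈p-y i (e≢f ∘ sym)) j (avoid e p ps)

module Trees {N : ℕ} (G : MultiGraph (suc N)) where
  open MultiGraph G renaming (m to edges)
  open Walks G

  -- The rest of a cycle is a detour around its first edge `e`, so `A - e` is still connected. By
  -- `crossing-bound` with all vertices coloured differently it has at least `N` edges, too many for
  -- a proper part of `A`.
  connected⇒acyclic : ∀ {A} → Connected G A → ∣ A ∣ ≤ N → Acyclic G A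
  connected⇒acyclic conn small nil (nonempty , _) = nonempty refl
  connected⇒acyclic {A} conn small (step {v} {w} e e∈A j p) (_ , e∉p ∷ _ , _) =
    <⇒≱ (<-≤-trans (x∈p⇒∣p-x∣<∣p∣ e∈A) small) N≤
    where
    detour : Walk G (A - e) v w
    detour = reverse (avoid e p e∉p)

    ends : ∀ {a b} → Joins G e a b → Joins G e v w → Walk G (A - e) a b
    ends (inj₁ (refl , refl)) (inj₁ (refl , refl)) = detour
    ends (inj₁ (refl , refl)) (inj₂ (refl , refl)) = reverse detour
    ends (inj₂ (refl , refl)) (inj₁ (refl , refl)) = reverse detour
    ends (inj₂ (refl , refl)) (inj₂ (refl , refl)) = detour

    reroute : ∀ f {a b} → f ∈ A → Joins G f a b → Walk G (A - e) a b
    reroute f f∈A j′ with e Fin.≟ f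
    ... | yes refl = ends j′ j
    ... | no  e≢f  = edgeWalk f (x∈p∧x≢y⇒x∈p-y f∈A (e≢f ∘ sym)) j′

    N≤ : N ≤ ∣ A - e ∣
    N≤ = subst (N ≤_) (sym (∣∣≡Σᶠ (A - e)))
      (crossing-bound (λ a b → walk-map reroute (conn a b)) id (λ i → i , refl) _
        (λ _ f∈ _ → ∈⇒1≤ f∈))

-- Abel summation, peeling off the constant f 0 at each step.
majorization : ∀ N (f : ℕ → ℕ) → (∀ i → f i ≤ f (suc i)) → (χ index : Fin m → ℕ) →
               (∀ j → j ≤ N → N ∸ j ≤ Σᶠ (λ e → χ e * ⟦ j ≤ᵇ index e ⟧)) →
               Σᶠ {N} (λ v → f (toℕ v)) ≤ Σᶠ (λ e → χ e * f (index e))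
majorization zero    f mono χ index large = z≤n
majorization (suc N) f mono χ index large = begin
  f 0 + Σᶠ {N} (λ v → f (suc (toℕ v)))
    ≡⟨ cong (f 0 +_) (sum-cong-≗ {N} (λ v → above-f0 (suc (toℕ v)))) ⟩
  f 0 + Σᶠ {N} (λ v → f 0 + g (toℕ v))
    ≡⟨ cong (f 0 +_) (∑-distrib-+ {N} (λ _ → f 0) (g ∘ toℕ)) ⟩
  f 0 + (Σᶠ {N} (λ _ → f 0) + Σᶠ {N} (g ∘ toℕ))
    ≡⟨ +-assoc (f 0) _ _ ⟨
  f 0 + Σᶠ {N} (λ _ → f 0) + Σᶠ {N} (g ∘ toℕ)
    ≡⟨ cong (_+ Σᶠ {N} (g ∘ toℕ)) (trans (Σᶠ-const (suc N) (f 0)) (*-comm (suc N) _)) ⟩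
  f 0 * suc N + Σᶠ {N} (g ∘ toℕ)
    ≤⟨ +-mono-≤ (*-monoʳ-≤ (f 0) (≤-trans (large 0 z≤n) (≤-reflexive (sum-cong-≗ (λ e → *-identityʳ (χ e))))))
         (majorization N g (λ i → ∸-monoˡ-≤ (f 0) (mono (suc i))) χ′ (λ e → pred (index e)) large′) ⟩
  f 0 * Σᶠ χ + Σᶠ (λ e → χ′ e * g (pred (index e)))
    ≡⟨ cong (_+ Σᶠ (λ e → χ′ e * g (pred (index e)))) (Σᶠ-*ˡ (f 0) χ) ⟨
  Σᶠ (λ e → f 0 * χ e) + Σᶠ (λ e → χ′ e * g (pred (index e)))
    ≡⟨ ∑-distrib-+ (λ e → f 0 * χ e) _ ⟨
  Σᶠ (λ e → f 0 * χ e + χ′ e * g (pred (index e)))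
    ≡⟨ sum-cong-≗ (λ e → recombine (χ e) (index e)) ⟩
  Σᶠ (λ e → χ e * f (index e)) ∎
  where
  open ≤-Reasoning
  g : ℕ → ℕ
  g i = f (suc i) ∸ f 0
  χ′ : Fin _ → ℕ
  χ′ e = χ e * ⟦ 1 ≤ᵇ index e ⟧
  f0≤ : ∀ i → f 0 ≤ f i
  f0≤ zero    = ≤-refl
  f0≤ (suc i) = ≤-trans (f0≤ i) (mono i)
  above-f0 : ∀ i → f i ≡ f 0 + (f i ∸ f 0)
  above-f0 i = sym (m+[n∸m]≡n (f0≤ i))
  recombine : ∀ x i → f 0 * x + x * ⟦ 1 ≤ᵇ i ⟧ * g (pred i) ≡ x * f i
  recombine x zero    = trans (cong₂ _+_ (*-comm (f 0) x) (cong (_* g 0) (*-zeroʳ x))) (+-identityʳ _)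
  recombine x (suc i) = begin-equality
    f 0 * x + x * 1 * g i ≡⟨ cong₂ _+_ (*-comm (f 0) x) (cong (_* g i) (*-identityʳ x)) ⟩
    x * f 0 + x * g i     ≡⟨ *-distribˡ-+ x (f 0) (g i) ⟨
    x * (f 0 + g i)       ≡⟨ cong (x *_) (above-f0 (suc i)) ⟨
    x * f (suc i)         ∎
  shift : ∀ j i → ⟦ suc j ≤ᵇ i ⟧ ≡ ⟦ 1 ≤ᵇ i ⟧ * ⟦ j ≤ᵇ pred i ⟧
  shift j zero          = refl
  shift zero (suc i)    = refl
  shift (suc j) (suc i) = sym (+-identityʳ _)
  large′ : ∀ j → j ≤ N → N ∸ j ≤ Σᶠ (λ e → χ′ e * ⟦ j ≤ᵇ pred (index e) ⟧)
  large′ j j≤N = ≤-trans (large (suc j) (s≤s j≤N)) (≤-reflexive (sum-cong-≗ λ e →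
    trans (cong (χ e *_) (shift j (index e))) (sym (*-assoc (χ e) _ _))))

-- Load dynamics of the fan

-- The loads of the two edges by which a fan vertex is attached to earlier
-- vertices; they differ by at most one, and the argument is the smaller one.
data State : Set where
  level spokeUp rimUp : ℕ → State

height spokeLoad rimLoad total : State → ℕ

height (level h)   = h
height (spokeUp h) = h
height (rimUp h)   = h

spokeLoad (spokeUp h) = suc h
spokeLoad s           = height s

rimLoad (rimUp h) = suc h
rimLoad s         = height s

total (level h)   = h + h
total (spokeUp h) = suc (h + h)
total (rimUp h)   = suc (h + h)

-- Equal totals alone do not suffice: at an odd total only one of the two edges has the smaller
-- load, so there is no tie to exploit.
linked : State → State → Bool
linked (level h) (level h′) = h ≡ᵇ h′
linked _         _          = false

-- A maximal run of linked vertices forms a path of rim edges, joined to the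
-- hub by the spoke of its last vertex; so the first vertex of the run uses
-- no edge and the last one uses two.
usesSpoke usesRim : (below above : Bool) → State → Bool

usesSpoke b a (level _)   = not a
usesSpoke b a (spokeUp _) = false
usesSpoke b a (rimUp _)   = true

usesRim b a (level _)   = b
usesRim b a (spokeUp _) = true
usesRim b a (rimUp _)   = false

next : (below above : Bool) → State → State
next _     _     (spokeUp h) = level (suc h)
next _     _     (rimUp h)   = level (suc h)
next false false (level h)   = spokeUp h
next false true  (level h)   = level h
next true  false (level h)   = level (suc h)
next true  true  (level h)   = rimUp h

degree : (below above : Bool) → State → ℕ
degree b a s = ⟦ usesSpoke b a s ⟧ + ⟦ usesRim b a s ⟧

data Fits : (below above : Bool) → State → Set where
  level   : ∀ {b a h} → Fits b a (level h)
  spokeUp : ∀ {h} → Fits false false (spokeUp h)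
  rimUp   : ∀ {h} → Fits false false (rimUp h)

spokeLoad-next : ∀ b a s → spokeLoad (next b a s) ≡ ⟦ usesSpoke b a s ⟧ + spokeLoad s
spokeLoad-next false false (level h)   = refl
spokeLoad-next false true  (level h)   = refl
spokeLoad-next true  false (level h)   = refl
spokeLoad-next true  true  (level h)   = refl
spokeLoad-next _     _     (spokeUp h) = refl
spokeLoad-next _     _     (rimUp h)   = refl

rimLoad-next : ∀ b a s → rimLoad (next b a s) ≡ ⟦ usesRim b a s ⟧ + rimLoad s
rimLoad-next false false (level h)   = refl
rimLoad-next false true  (level h)   = refl
rimLoad-next true  false (level h)   = refl
rimLoad-next true  true  (level h)   = refl
rimLoad-next _     _     (spokeUp h) = refl
rimLoad-next _     _     (rimUp h)   = refl

total-next : ∀ b a s → total (next b a s) ≡ degree b a s + total s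
total-next false false (level h)   = refl
total-next false true  (level h)   = refl
total-next true  false (level h)   = cong suc (+-suc h h)
total-next true  true  (level h)   = refl
total-next _     _     (spokeUp h) = cong suc (+-suc h h)
total-next _     _     (rimUp h)   = cong suc (+-suc h h)

height≤spokeLoad : ∀ s → height s ≤ spokeLoad s
height≤spokeLoad (level h)   = ≤-refl
height≤spokeLoad (spokeUp h) = n≤1+n h
height≤spokeLoad (rimUp h)   = ≤-refl

height≤rimLoad : ∀ s → height s ≤ rimLoad s
height≤rimLoad (level h)   = ≤-refl
height≤rimLoad (spokeUp h) = ≤-refl
height≤rimLoad (rimUp h)   = n≤1+n h

spokeLoad≡height : ∀ b a s → usesSpoke b a s ≡ true → spokeLoad s ≡ height s
spokeLoad≡height b a (level h) _ = refl
spokeLoad≡height b a (rimUp h) _ = refl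

rimLoad≡height : ∀ b a s → usesRim b a s ≡ true → rimLoad s ≡ height s
rimLoad≡height b a (level h)   _ = refl
rimLoad≡height b a (spokeUp h) _ = refl

total≡loads : ∀ s → total s ≡ spokeLoad s + rimLoad s
total≡loads (level h)   = refl
total≡loads (spokeUp h) = refl
total≡loads (rimUp h)   = sym (+-suc h h)

double-cancel-≤ : ∀ {a b} → a + a ≤ suc (b + b) → a ≤ b
double-cancel-≤ {zero}          _ = z≤n
double-cancel-≤ {suc a} {zero}  (s≤s p) = contradiction (subst (_≤ 0) (+-suc a a) p) λ ()
double-cancel-≤ {suc a} {suc b} (s≤s p) =
  s≤s (double-cancel-≤ (≤-pred (subst₂ _≤_ (+-suc a a) (cong suc (+-suc b b)) p)))

-- The height is half of the total, rounded down.
height-mono : ∀ s s′ → total s ≤ total s′ → height s ≤ height s′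
height-mono s s′ t≤ = double-cancel-≤ (≤-trans (lower s) (≤-trans t≤ (upper s′)))
  where
  lower : ∀ s → height s + height s ≤ total s
  lower (level h)   = ≤-refl
  lower (spokeUp h) = n≤1+n _
  lower (rimUp h)   = n≤1+n _
  upper : ∀ s → total s ≤ suc (height s + height s)
  upper (level h)   = n≤1+n _
  upper (spokeUp h) = ≤-refl
  upper (rimUp h)   = ≤-refl

degree≤2 : ∀ b a s → degree b a s ≤ 2
degree≤2 b a s = +-mono-≤ (bit (usesSpoke b a s)) (bit (usesRim b a s))
  where
  bit : ∀ x → ⟦ x ⟧ ≤ 1
  bit false = z≤n
  bit true  = ≤-refl

-- This is the chip-firing rule: each vertex has one edge to spend, receives another through a link
-- from below and passes one on through a link above. `Fits` records that odd vertices have no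
-- links.
degree-balance : ∀ {b a s} → Fits b a s → degree b a s + ⟦ a ⟧ ≡ 1 + ⟦ b ⟧
degree-balance {false} {false} level = refl
degree-balance {false} {true}  level = refl
degree-balance {true}  {false} level = refl
degree-balance {true}  {true}  level = refl
degree-balance spokeUp = refl
degree-balance rimUp   = refl

fits-if-level : ∀ b a s → (b ≡ true → ∃[ h ] s ≡ level h) → (a ≡ true → ∃[ h ] s ≡ level h) →
                Fits b a s
fits-if-level b     a     (level h)   _ _ = level
fits-if-level false false (spokeUp h) _ _ = spokeUp
fits-if-level false false (rimUp h)   _ _ = rimUp
fits-if-level true  _     (spokeUp h) p _ with () ← proj₂ (p refl)
fits-if-level true  _     (rimUp h)   p _ with () ← proj₂ (p refl)
fits-if-level false true  (spokeUp h) _ p with () ← proj₂ (p refl)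
fits-if-level false true  (rimUp h)   _ p with () ← proj₂ (p refl)

linked-level : ∀ s s′ → linked s s′ ≡ true → ∃[ h ] s ≡ level h × s′ ≡ level h
linked-level (level h) (level h′) eq with h ≟ h′
... | yes refl = h , refl , refl
... | no  h≢h′ = contradiction (trans (sym (dec-false (h ≟ h′) h≢h′)) eq) λ ()

halves-≡ᵇ : ∀ a b → a + a ≡ b + b → (a ≡ᵇ b) ≡ true
halves-≡ᵇ a b eq = dec-true (a ≟ b) (≤-antisym (double-cancel-≤ {a} {b} (m≤n⇒m≤1+n (≤-reflexive eq)))
                                                (double-cancel-≤ {b} {a} (m≤n⇒m≤1+n (≤-reflexive (sym eq)))))

double≢suc-double : ∀ a b → a + a ≢ suc (b + b)
double≢suc-double a b eq = <⇒≢ (s≤s (+-mono-≤ a≤b a≤b)) eq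
  where a≤b = double-cancel-≤ {a} {b} (≤-reflexive eq)

-- Parity decides: equal even totals are levels of the same height, hence linked now. With equal odd
-- totals each vertex must use its lighter edge, whatever the flags are, and both become the same
-- level one round later.
total-≡ : ∀ s s′ → total s ≡ total s′ →
          linked s s′ ≡ true ⊎ (∀ b a b′ a′ → linked (next b a s) (next b′ a′ s′) ≡ true)
total-≡ (level h) (level h′) eq =
  inj₁ (halves-≡ᵇ h h′ eq)
total-≡ (level h) (spokeUp h′) eq = contradiction eq (double≢suc-double h h′)
total-≡ (level h) (rimUp h′)   eq = contradiction eq (double≢suc-double h h′)
total-≡ (spokeUp h) (level h′) eq = contradiction (sym eq) (double≢suc-double h′ h)
total-≡ (rimUp h)   (level h′) eq = contradiction (sym eq) (double≢suc-double h′ h)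
total-≡ (spokeUp h) (spokeUp h′) eq =
  inj₂ λ _ _ _ _ → halves-≡ᵇ h h′ (suc-injective eq)
total-≡ (spokeUp h) (rimUp h′) eq =
  inj₂ λ _ _ _ _ → halves-≡ᵇ h h′ (suc-injective eq)
total-≡ (rimUp h) (spokeUp h′) eq =
  inj₂ λ _ _ _ _ → halves-≡ᵇ h h′ (suc-injective eq)
total-≡ (rimUp h) (rimUp h′) eq =
  inj₂ λ _ _ _ _ → halves-≡ᵇ h h′ (suc-injective eq)

-- Linked vertices: the lower gains at most 1 and the upper at least 1. Unlinked levels have totals
-- at least 2 apart, which covers the largest possible gain. If the parities differ, the odd vertex
-- gains exactly 1 and the parity gap supplies the rest; two odd vertices both gain 1.
next-mono : ∀ b a s s′ → total s ≤ total s′ →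
            total (next b (linked s s′) s) ≤ total (next (linked s s′) a s′)
next-mono b a s s′ t≤ = subst₂ _≤_ (sym (total-next b _ s)) (sym (total-next _ a s′)) (go s s′ t≤)
  where
  even-odd : ∀ h h′ → h + h ≤ suc (h′ + h′) →
             degree b false (level h) + (h + h) ≤ suc (suc (h′ + h′))
  even-odd h h′ t≤ = +-mono-≤ (degree≤2 b false (level h)) (+-mono-≤ h≤h′ h≤h′)
    where h≤h′ = double-cancel-≤ {h} {h′} t≤

  odd-even : ∀ h h′ d → suc (h + h) ≤ h′ + h′ → suc (suc (h + h)) ≤ d + (h′ + h′)
  odd-even h h′ d t≤ = ≤-trans
    (≤∧≢⇒< t≤ (λ eq → double≢suc-double h′ h (sym eq))) (m≤n+m _ d)

  go : ∀ s s′ → total s ≤ total s′ →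
       degree b (linked s s′) s + total s ≤ degree (linked s s′) a s′ + total s′
  go (level h) (level h′) t≤ with h ≡ᵇ h′ in eq
  ... | true  = +-mono-≤ (≤-trans (bit b) (m≤n+m 1 ⟦ not a ⟧)) t≤
    where
    bit : ∀ x → ⟦ x ⟧ ≤ 1
    bit false = z≤n
    bit true  = ≤-refl
  ... | false = ≤-trans (+-monoˡ-≤ (h + h) (degree≤2 b false (level h)))
                  (≤-trans spread (m≤n+m _ (degree false a (level h′))))
    where
    h<h′ : h < h′
    h<h′ = ≤∧≢⇒< (double-cancel-≤ (m≤n⇒m≤1+n t≤))
             λ h≡h′ → contradiction (trans (sym (dec-true (h ≟ h′) h≡h′)) eq) λ ()
    spread : suc (suc (h + h)) ≤ h′ + h′
    spread = subst (_≤ h′ + h′) (cong suc (+-suc h h)) (+-mono-≤ h<h′ h<h′)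
  go (level h) (spokeUp h′) t≤ = even-odd h h′ t≤
  go (level h) (rimUp h′)   t≤ = even-odd h h′ t≤
  go (spokeUp h) (level h′) t≤ = odd-even h h′ (degree false a (level h′)) t≤
  go (rimUp h)   (level h′) t≤ = odd-even h h′ (degree false a (level h′)) t≤
  go (spokeUp h) (spokeUp h′) t≤ = s≤s t≤
  go (spokeUp h) (rimUp h′)   t≤ = s≤s t≤
  go (rimUp h)   (spokeUp h′) t≤ = s≤s t≤
  go (rimUp h)   (rimUp h′)   t≤ = s≤s t≤

-- Sums over initial segments and the telescoping identity

∑< : ℕ → (ℕ → ℕ) → ℕ
∑< k g = Σᶠ {k} (g ∘ toℕ)

∑<-cong : ∀ k {f g : ℕ → ℕ} → (∀ i → i < k → f i ≡ g i) → ∑< k f ≡ ∑< k g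
∑<-cong k f≡g = sum-cong-≗ {k} (λ i → f≡g (toℕ i) (toℕ<n i))

∑<-mono : ∀ k {f g : ℕ → ℕ} → (∀ i → i < k → f i ≤ g i) → ∑< k f ≤ ∑< k g
∑<-mono k f≤g = Σᶠ-mono {k} (λ i → f≤g (toℕ i) (toℕ<n i))

∑<-distrib-+ : ∀ k (f g : ℕ → ℕ) → ∑< k (λ i → f i + g i) ≡ ∑< k f + ∑< k g
∑<-distrib-+ k f g = ∑-distrib-+ {k} (f ∘ toℕ) (g ∘ toℕ)

∑<-last : ∀ k (h : ℕ → ℕ) → ∑< k h + h k ≡ ∑< (suc k) h
∑<-last zero    h = sym (+-identityʳ (h 0))
∑<-last (suc k) h = trans (+-assoc (h 0) _ _) (cong (h 0 +_) (∑<-last k (h ∘ suc)))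

-- δ i is the number of edges chosen at vertex i and x marks the links, which
-- vanish at both ends.
telescope : ∀ k (g δ x : ℕ → ℕ) → x 0 ≡ 0 → x k ≡ 0 →
            (∀ i → i < k → δ i + x (suc i) ≡ 1 + x i) →
            ∑< k (λ i → g i * δ i) + ∑< k (λ i → g i * x (suc i)) ≡
            ∑< k g + ∑< k (λ i → g (suc i) * x (suc i))
telescope k g δ x x0 xk balance = begin
  ∑< k (λ i → g i * δ i) + ∑< k (λ i → g i * x (suc i))
    ≡⟨ ∑<-distrib-+ k (λ i → g i * δ i) (λ i → g i * x (suc i)) ⟨
  ∑< k (λ i → g i * δ i + g i * x (suc i))
    ≡⟨ ∑<-cong k (λ i i<k → trans (sym (*-distribˡ-+ (g i) (δ i) (x (suc i))))
         (trans (cong (g i *_) (balance i i<k)) (*-suc (g i) (x i)))) ⟩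
  ∑< k (λ i → g i + g i * x i)
    ≡⟨ ∑<-distrib-+ k g (λ i → g i * x i) ⟩
  ∑< k g + ∑< k (λ i → g i * x i)
    ≡⟨ cong (∑< k g +_) shift ⟩
  ∑< k g + ∑< k (λ i → g (suc i) * x (suc i)) ∎
  where
  open ≡-Reasoning
  vanish : ∀ i → x i ≡ 0 → g i * x i ≡ 0
  vanish i xi = trans (cong (g i *_) xi) (*-zeroʳ (g i))
  shift : ∑< k (λ i → g i * x i) ≡ ∑< k (λ i → g (suc i) * x (suc i))
  shift = begin
    ∑< k (λ i → g i * x i)             ≡⟨ +-identityʳ _ ⟨
    ∑< k (λ i → g i * x i) + 0         ≡⟨ cong (∑< k (λ i → g i * x i) +_) (vanish k xk) ⟨
    ∑< k (λ i → g i * x i) + g k * x k ≡⟨ ∑<-last k (λ i → g i * x i) ⟩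
    ∑< (suc k) (λ i → g i * x i)       ≡⟨ cong (_+ ∑< k (λ i → g (suc i) * x (suc i))) (vanish 0 x0) ⟩
    ∑< k (λ i → g (suc i) * x (suc i)) ∎

-- The evolution of the loads over the rounds

module Evolution (k : ℕ) where

  -- From index `k` on, `below` is true and `above` false by fiat. A leaf then behaves like the last
  -- vertex of a run and rises by a full level in every round, as if it had a second, fictitious
  -- edge.
  below above : (ℕ → State) → ℕ → Bool
  below s zero    = k ≤ᵇ 0
  below s (suc i) = (k ≤ᵇ suc i) ∨ linked (s i) (s (suc i))
  above s i       = (suc i <ᵇ k) ∧ linked (s i) (s (suc i))

  -- Vertices i ≥ k stand for leaves, whose single edge is used in every tree.
  state : ℕ → ℕ → State
  state zero    i = level 0
  state (suc q) i = next (below (state q) i) (above (state q) i) (state q i)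

  private
    ≤ᵇ-true : ∀ {a b} → a ≤ b → (a ≤ᵇ b) ≡ true
    ≤ᵇ-true {a} {b} a≤b = dec-true (a ≤? b) a≤b
    ≤ᵇ-false : ∀ {a b} → b < a → (a ≤ᵇ b) ≡ false
    ≤ᵇ-false {a} {b} b<a = dec-false (a ≤? b) (<⇒≱ b<a)

  below-leaf : ∀ s {i} → k ≤ i → below s i ≡ true
  below-leaf s {zero}  k≤i = ≤ᵇ-true k≤i
  below-leaf s {suc i} k≤i = cong (_∨ linked (s i) (s (suc i))) (≤ᵇ-true k≤i)

  below-first : ∀ s → 0 < k → below s 0 ≡ false
  below-first s 0<k = ≤ᵇ-false 0<k

  below-fan : ∀ s {i} → suc i < k → below s (suc i) ≡ linked (s i) (s (suc i))
  below-fan s {i} i<k = cong (_∨ linked (s i) (s (suc i))) (≤ᵇ-false i<k)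

  above-outside : ∀ s {i} → k ≤ suc i → above s i ≡ false
  above-outside s {i} k≤i = cong (_∧ linked (s i) (s (suc i))) (≤ᵇ-false (s≤s k≤i))

  above-fan : ∀ s {i} → suc i < k → above s i ≡ linked (s i) (s (suc i))
  above-fan s {i} i<k = cong (_∧ linked (s i) (s (suc i))) (≤ᵇ-true i<k)

  above⇒ : ∀ s {i} → above s i ≡ true → suc i < k × linked (s i) (s (suc i)) ≡ true
  above⇒ s {i} eq with suc i <? k
  ... | yes i<k = i<k , trans (sym (above-fan s i<k)) eq
  ... | no  i≮k = contradiction (trans (sym (above-outside s (≮⇒≥ i≮k))) eq) λ ()

  state-leaf : ∀ q {i} → k ≤ i → state q i ≡ level q
  state-leaf zero    k≤i = refl
  state-leaf (suc q) {i} k≤i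
    rewrite below-leaf (state q) k≤i | above-outside (state q) (m≤n⇒m≤1+n k≤i) | state-leaf q k≤i = refl

  total≤ : ∀ q i → total (state q i) ≤ q + q
  total≤ zero    i = z≤n
  total≤ (suc q) i = begin
    total (state (suc q) i)          ≡⟨ total-next (below (state q) i) _ (state q i) ⟩
    degree _ _ (state q i) + total (state q i) ≤⟨ +-mono-≤ (degree≤2 (below (state q) i) _ (state q i)) (total≤ q i) ⟩
    suc (suc (q + q))                ≡⟨ cong suc (+-suc q q) ⟨
    suc q + suc q                    ∎
    where open ≤-Reasoning

  -- Inside the fan this is `next-mono`. At the border with the leaves it holds because a leaf gains
  -- 2, the most possible, in every round. Thus the heights are monotone over all indices, as
  -- `majorization` requires.
  total-mono : ∀ q i → total (state q i) ≤ total (state q (suc i))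
  total-mono q i with suc i <? k
  total-mono q i | no i≮k = ≤-trans (total≤ q i) (≤-reflexive (cong total (sym (state-leaf q (≮⇒≥ i≮k)))))
  total-mono zero    i | yes i<k = z≤n
  total-mono (suc q) i | yes i<k
    rewrite above-fan (state q) i<k | below-fan (state q) i<k =
    next-mono (below (state q) i) (above (state q) (suc i)) (state q i) (state q (suc i)) (total-mono q i)

  height-monotone : ∀ q i → height (state q i) ≤ height (state q (suc i))
  height-monotone q i = height-mono (state q i) (state q (suc i)) (total-mono q i)

  below⇒level : ∀ s {i} → i < k → below s i ≡ true → ∃[ h ] s i ≡ level h
  below⇒level s {zero}  i<k eq = contradiction (trans (sym (below-first s i<k)) eq) λ ()
  below⇒level s {suc i} i<k eq =
    let h , _ , si≡ = linked-level (s i) (s (suc i)) (trans (sym (below-fan s i<k)) eq) in h , si≡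

  above⇒level : ∀ s {i} → above s i ≡ true → ∃[ h ] s i ≡ level h
  above⇒level s {i} eq =
    let h , si≡ , _ = linked-level (s i) (s (suc i)) (proj₂ (above⇒ s eq)) in h , si≡

  fits : ∀ q {i} → i < k → Fits (below (state q) i) (above (state q) i) (state q i)
  fits q i<k = fits-if-level _ _ _ (below⇒level (state q) i<k) (above⇒level (state q))

  spokeUsed rimUsed : ℕ → ℕ → Bool
  spokeUsed q i = usesSpoke (below (state q) i) (above (state q) i) (state q i)
  rimUsed   q i = usesRim   (below (state q) i) (above (state q) i) (state q i)

  degreeAt link : ℕ → ℕ → ℕ
  degreeAt q i = ⟦ spokeUsed q i ⟧ + ⟦ rimUsed q i ⟧
  link q zero    = 0
  link q (suc i) = ⟦ above (state q) i ⟧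

  link-end : ∀ q → link q k ≡ 0
  link-end q = end k refl
    where
    end : ∀ j → j ≡ k → link q j ≡ 0
    end zero    _    = refl
    end (suc j) refl = cong ⟦_⟧ (above-outside (state q) ≤-refl)

  link-below : ∀ q i → i < k → ⟦ below (state q) i ⟧ ≡ link q i
  link-below q zero    i<k = cong ⟦_⟧ (below-first (state q) i<k)
  link-below q (suc i) i<k = cong ⟦_⟧ (trans (below-fan (state q) i<k) (sym (above-fan (state q) i<k)))

  balance : ∀ q i → i < k → degreeAt q i + link q (suc i) ≡ 1 + link q i
  balance q i i<k = trans (degree-balance (fits q i<k)) (cong suc (link-below q i i<k))

  degree-telescope : ∀ q (g : ℕ → ℕ) →
    ∑< k (λ i → g i * degreeAt q i) + ∑< k (λ i → g i * link q (suc i)) ≡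
    ∑< k g + ∑< k (λ i → g (suc i) * link q (suc i))
  degree-telescope q g = telescope k g (degreeAt q) (link q) refl (link-end q) (balance q)

  -- Links join vertices of equal height, so moving edges along them is free.
  ∑-height : ∀ q → ∑< k (λ i → height (state q i) * degreeAt q i) ≡ ∑< k (λ i → height (state q i))
  ∑-height q = +-cancelʳ-≡ (∑< k (λ i → height (state q i) * link q (suc i))) _ _
    (trans (degree-telescope q (λ i → height (state q i)))
      (cong (∑< k (λ i → height (state q i)) +_) (∑<-cong k (λ i _ → sym (same i)))))
    where
    same : ∀ i → height (state q i) * link q (suc i) ≡ height (state q (suc i)) * link q (suc i)
    same i with above (state q) i in eq
    ... | false = trans (*-zeroʳ (height (state q i))) (sym (*-zeroʳ (height (state q (suc i)))))
    ... | true  with linked-level (state q i) (state q (suc i)) (proj₂ (above⇒ (state q) eq))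
    ...   | h , eq₁ , eq₂ = cong (_* 1) (trans (cong height eq₁) (sym (cong height eq₂)))

  ∑-degree : ∀ q → ∑< k (degreeAt q) ≡ k
  ∑-degree q = +-cancelʳ-≡ (∑< k (λ i → 1 * link q (suc i))) _ _ (begin
    ∑< k (degreeAt q) + ∑< k (λ i → 1 * link q (suc i))
      ≡⟨ cong (_+ ∑< k (λ i → 1 * link q (suc i))) (∑<-cong k (λ i _ → sym (*-identityˡ (degreeAt q i)))) ⟩
    ∑< k (λ i → 1 * degreeAt q i) + ∑< k (λ i → 1 * link q (suc i))
      ≡⟨ degree-telescope q (λ _ → 1) ⟩
    ∑< k (λ _ → 1) + ∑< k (λ i → 1 * link q (suc i))
      ≡⟨ cong (_+ ∑< k (λ i → 1 * link q (suc i))) (trans (Σᶠ-const k 1) (*-identityʳ k)) ⟩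
    k + ∑< k (λ i → 1 * link q (suc i)) ∎)
    where open ≡-Reasoning

  total-suc : ∀ q i → total (state (suc q) i) ≡ degreeAt q i + total (state q i)
  total-suc q i = total-next _ _ (state q i)

  moment links : ℕ → ℕ
  moment q = ∑< k (λ i → i * total (state q i))
  links q  = ∑< k (λ i → link q (suc i))

  ranks : ℕ
  ranks = ∑< k id

  -- One edge per vertex would add `ranks` to the moment; each link shifts one of these units to the
  -- next index and so adds 1 more. The excess of the moment over `q * ranks` therefore counts the
  -- links so far.
  moment-suc : ∀ q → moment (suc q) ≡ moment q + ranks + links q
  moment-suc q = +-cancelʳ-≡ L _ _ (begin
    moment (suc q) + L
      ≡⟨ cong (_+ L) (trans (∑<-cong k (λ i _ → trans (cong (i *_) (total-suc q i)) (*-distribˡ-+ i (degreeAt q i) (total (state q i)))))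
           (∑<-distrib-+ k (λ i → i * degreeAt q i) (λ i → i * total (state q i)))) ⟩
    D + moment q + L               ≡⟨ solve 3 (λ d m l → d :+ m :+ l := m :+ (d :+ l)) refl D (moment q) L ⟩
    moment q + (D + L)             ≡⟨ cong (moment q +_) (degree-telescope q id) ⟩
    moment q + (ranks + ∑< k (λ i → suc i * link q (suc i)))
      ≡⟨ cong (λ s → moment q + (ranks + s)) (∑<-distrib-+ k (λ i → link q (suc i)) (λ i → i * link q (suc i))) ⟩
    moment q + (ranks + (links q + L))
      ≡⟨ solve 4 (λ m r l s → m :+ (r :+ (l :+ s)) := m :+ r :+ l :+ s) refl (moment q) ranks (links q) L ⟩
    moment q + ranks + links q + L ∎)
    where
    open ≡-Reasoning
    D = ∑< k (λ i → i * degreeAt q i)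
    L = ∑< k (λ i → i * link q (suc i))

  Strict : ℕ → Set
  Strict q = ∀ i → suc i < k → total (state q i) < total (state q (suc i))

  strict? : ∀ q → Strict q ⊎ (∃[ i ] suc i < k × total (state q i) ≡ total (state q (suc i)))
  strict? q with anyUpTo? (λ i → suc i <? k ×-dec total (state q i) ≟ total (state q (suc i))) k
  ... | yes (i , _ , i<k , eq) = inj₂ (i , i<k , eq)
  ... | no  none = inj₁ λ i i<k → ≤∧≢⇒< (total-mono q i)
                     λ eq → none (i , <-trans (n<1+n i) i<k , i<k , eq)

  link-strict : ∀ q → Strict q → ∀ i → link q i ≡ 0
  link-strict q strict zero    = refl
  link-strict q strict (suc i) with above (state q) i in eq
  ... | false = refl
  ... | true  with above⇒ (state q) eq
  ...   | i<k , lk with linked-level (state q i) (state q (suc i)) lk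
  ...     | h , eq₁ , eq₂ = contradiction (trans (cong total eq₁) (sym (cong total eq₂))) (<⇒≢ (strict i i<k))

  -- Linked vertices have equal totals, so strictness rules out all links. Every fan vertex then
  -- gains exactly 1 and the differences are frozen.
  strict-suc : ∀ q → Strict q → Strict (suc q)
  strict-suc q strict i i<k = subst₂ _<_
    (sym (advance i (<-trans (n<1+n i) i<k))) (sym (advance (suc i) i<k)) (s≤s (strict i i<k))
    where
    advance : ∀ i → i < k → total (state (suc q) i) ≡ suc (total (state q i))
    advance i i<k = trans (total-suc q i) (cong (_+ total (state q i)) (begin
      degreeAt q i                   ≡⟨ +-identityʳ _ ⟨
      degreeAt q i + 0               ≡⟨ cong (degreeAt q i +_) (link-strict q strict (suc i)) ⟨
      degreeAt q i + link q (suc i)  ≡⟨ balance q i i<k ⟩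
      suc (link q i)                 ≡⟨ cong suc (link-strict q strict i) ⟩
      1                              ∎))
      where open ≡-Reasoning

  links≥1 : ∀ q i → suc i < k → linked (state q i) (state q (suc i)) ≡ true → 1 ≤ links q
  links≥1 q i i<k lk = ≤-trans (≤-reflexive (sym at-i)) (term≤Σᶠ {k} (λ j → link q (suc (toℕ j))) (fromℕ< i<k′))
    where
    i<k′ = <-trans (n<1+n i) i<k
    at-i : link q (suc (toℕ (fromℕ< i<k′))) ≡ 1
    at-i = trans (cong (link q ∘ suc) (toℕ-fromℕ< i<k′)) (cong ⟦_⟧ (trans (above-fan (state q) i<k) lk))

  -- Every link shifts one unit of load upwards by one place, and two equal totals
  -- produce a link within two rounds.
  drift : 2 ≤ k → ∀ q → Strict q ⊎ (q + 2 * (q * ranks) ≤ 2 * moment q)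
  drift 2≤k zero          = inj₂ z≤n
  drift 2≤k (suc zero)    = inj₂ (begin
    1 + 2 * (1 * ranks)                    ≡⟨ cong (λ r → 1 + 2 * r) (*-identityˡ ranks) ⟩
    1 + 2 * ranks                          ≤⟨ +-monoˡ-≤ (2 * ranks) (n≤1+n 1) ⟩
    2 + 2 * ranks                          ≡⟨ *-distribˡ-+ 2 1 ranks ⟨
    2 * (1 + ranks)                        ≤⟨ *-monoʳ-≤ 2 (≤-trans (≤-reflexive (+-comm 1 ranks)) (+-mono-≤ (m≤n+m ranks (moment 0)) (links≥1 0 0 2≤k refl))) ⟩
    2 * (moment 0 + ranks + links 0)       ≡⟨ cong (2 *_) (moment-suc 0) ⟨
    2 * moment 1                           ∎)
    where open ≤-Reasoning
  drift 2≤k (suc (suc q)) with drift 2≤k q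
  ... | inj₁ strict = inj₁ (strict-suc (suc q) (strict-suc q strict))
  ... | inj₂ large with strict? q
  ...   | inj₁ strict = inj₁ (strict-suc (suc q) (strict-suc q strict))
  ...   | inj₂ (i , i<k , eq) = inj₂ (begin
    2 + q + 2 * ((2 + q) * ranks)
      ≡⟨ solve 2 (λ q r → con 2 :+ q :+ con 2 :* ((con 2 :+ q) :* r) :=
                          (q :+ con 2 :* (q :* r)) :+ con 2 :* (r :+ r :+ con 1)) refl q ranks ⟩
    q + 2 * (q * ranks) + 2 * (ranks + ranks + 1)
      ≤⟨ +-mono-≤ large (*-monoʳ-≤ 2 (+-monoʳ-≤ (ranks + ranks) active)) ⟩
    2 * moment q + 2 * (ranks + ranks + (links q + links (suc q)))
      ≡⟨ solve 4 (λ m r a b → con 2 :* m :+ con 2 :* (r :+ r :+ (a :+ b)) :=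
                              con 2 :* (m :+ r :+ a :+ r :+ b)) refl (moment q) ranks (links q) (links (suc q)) ⟩
    2 * (moment q + ranks + links q + ranks + links (suc q))
      ≡⟨ cong (λ m → 2 * (m + ranks + links (suc q))) (moment-suc q) ⟨
    2 * (moment (suc q) + ranks + links (suc q))
      ≡⟨ cong (2 *_) (moment-suc (suc q)) ⟨
    2 * moment (2 + q) ∎)
    where
    open ≤-Reasoning
    active : 1 ≤ links q + links (suc q)
    active with total-≡ (state q i) (state q (suc i)) eq
    ... | inj₁ lk = ≤-trans (links≥1 q i i<k lk) (m≤m+n _ _)
    ... | inj₂ lk = ≤-trans (links≥1 (suc q) i i<k (lk _ _ _ _)) (m≤n+m _ (links q))

  -- Nothing below the first vertex can pass an edge to it, so it gains at most 1 per round.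
  first-total≤ : 0 < k → ∀ q → total (state q 0) ≤ q
  first-total≤ 0<k zero    = z≤n
  first-total≤ 0<k (suc q) = ≤-trans (≤-reflexive (total-suc q 0))
    (+-mono-≤ (≤-trans (m≤m+n _ _) (≤-reflexive (balance q 0 0<k))) (first-total≤ 0<k q))

  strict-spread : ∀ q → Strict q → ∀ i → i < k → i + total (state q 0) ≤ total (state q i)
  strict-spread q strict zero    _   = ≤-refl
  strict-spread q strict (suc i) i<k =
    ≤-trans (s≤s (strict-spread q strict i (<-trans (n<1+n i) i<k))) (strict i i<k)

  total-mono* : ∀ q d i → total (state q i) ≤ total (state q (i + d))
  total-mono* q zero    i = ≤-reflexive (cong (total ∘ state q) (sym (+-identityʳ i)))
  total-mono* q (suc d) i = ≤-trans (total-mono* q d i)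
    (≤-trans (total-mono q (i + d)) (≤-reflexive (cong (total ∘ state q) (sym (+-suc i d)))))

  ranks≤ : ranks ≤ k * k
  ranks≤ = ≤-trans (∑<-mono k (λ i → <⇒≤)) (≤-reflexive (Σᶠ-const k k))

  -- Without strictness, `drift` makes the moment exceed `q * ranks` by at least q / 2. The moment
  -- is at most `ranks` times the largest total, which is that of the last vertex, while the first
  -- total is at most `q`. Hence the two ends differ by at least q / (2 `ranks`).
  spread : ∀ {t} → k ≡ suc t → 1 ≤ t → ∀ q →
           (t + total (state q 0) ≤ total (state q t)) ⊎
           (q + 2 * ranks * total (state q 0) ≤ 2 * ranks * total (state q t))
  spread {t} refl 1≤t q with drift (s≤s 1≤t) q
  ... | inj₁ strict = inj₁ (strict-spread q strict t ≤-refl)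
  ... | inj₂ large  = inj₂ (begin
    q + 2 * ranks * total (state q 0)  ≤⟨ +-monoʳ-≤ q (*-monoʳ-≤ (2 * ranks) (first-total≤ (s≤s z≤n) q)) ⟩
    q + 2 * ranks * q                  ≡⟨ cong (q +_) (trans (*-assoc 2 ranks q) (cong (2 *_) (*-comm ranks q))) ⟩
    q + 2 * (q * ranks)                ≤⟨ large ⟩
    2 * moment q                       ≤⟨ *-monoʳ-≤ 2 (∑<-mono k (λ i i<k → *-monoʳ-≤ i (below-last i i<k))) ⟩
    2 * ∑< k (λ i → i * T)             ≡⟨ cong (2 *_) (trans (∑<-cong k (λ i _ → *-comm i T)) (trans (Σᶠ-*ˡ {k} T toℕ) (*-comm T ranks))) ⟩
    2 * (ranks * T)                    ≡⟨ *-assoc 2 ranks T ⟨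
    2 * ranks * T                      ∎)
    where
    open ≤-Reasoning
    T = total (state q t)
    below-last : ∀ i → i < k → total (state q i) ≤ T
    below-last i (s≤s i≤t) = subst (λ j → total (state q i) ≤ total (state q j))
      (m+[n∸m]≡n i≤t) (total-mono* q (t ∸ i) i)

-- Tabulated subsets and sums over composite index sets

∈-tabulate : (f : Fin m → Bool) → ∀ {e} → f e ≡ true → e ∈ tabulate f
∈-tabulate f {e} eq = lookup⇒[]= e _ (trans (lookup∘tabulate f e) eq)

∈-tabulate⁻ : (f : Fin m → Bool) → ∀ {e} → e ∈ tabulate f → f e ≡ true
∈-tabulate⁻ f {e} e∈ = trans (sym (lookup∘tabulate f e)) ([]=⇒lookup e∈)

∧-true : ∀ {a b} → a ∧ b ≡ true → a ≡ true × b ≡ true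
∧-true {true} {true} _ = refl , refl

⟦∧⟧ : ∀ a b → ⟦ a ∧ b ⟧ ≡ ⟦ a ⟧ * ⟦ b ⟧
⟦∧⟧ true  b = sym (*-identityˡ ⟦ b ⟧)
⟦∧⟧ false b = refl

≡ᵇ-true : ∀ {a b} → (a ≡ᵇ b) ≡ true → a ≡ b
≡ᵇ-true {a} {b} eq with a ≟ b
... | yes a≡b = a≡b
... | no  a≢b = contradiction (trans (sym eq) (dec-false (a ≟ b) a≢b)) λ ()

≡ᵇ-false : ∀ {a b} → (a ≡ᵇ b) ≡ false → a ≢ b
≡ᵇ-false {a} {b} eq a≡b = contradiction (trans (sym eq) (dec-true (a ≟ b) a≡b)) λ ()

Σᶠ-↑ : ∀ a {b} (f : Fin (a + b) → ℕ) → Σᶠ f ≡ Σᶠ (λ i → f (i ↑ˡ b)) + Σᶠ (λ j → f (a ↑ʳ j))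
Σᶠ-↑ zero    f = refl
Σᶠ-↑ (suc a) f = trans (cong (f zero +_) (Σᶠ-↑ a (f ∘ suc))) (sym (+-assoc (f zero) _ _))

Σᶠ-combine : ∀ a b (f : Fin (a * b) → ℕ) → Σᶠ f ≡ Σᶠ {a} λ i → Σᶠ {b} λ j → f (combine i j)
Σᶠ-combine zero    b f = refl
Σᶠ-combine (suc a) b f = trans (Σᶠ-↑ b f) (cong (Σᶠ (λ j → f (j ↑ˡ a * b)) +_) (Σᶠ-combine a b (f ∘ (b ↑ʳ_))))

Σᶠ-select : ∀ l {r} → r < l → ∀ x → Σᶠ {l} (λ c → x * ⟦ toℕ c ≡ᵇ r ⟧) ≡ x
Σᶠ-select (suc l) {zero} _ x =
  trans (cong₂ _+_ (*-identityʳ x) (Σᶠ-zero {l} (λ c → *-zeroʳ x))) (+-identityʳ x)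
Σᶠ-select (suc l) {suc r} (s≤s r<l) x = trans (cong (_+ Σᶠ {l} (λ c → x * ⟦ toℕ c ≡ᵇ r ⟧)) (*-zeroʳ x)) (Σᶠ-select l r<l x)

-- The graph and its greedy packing

-- k fan vertices, 1 + p′ leaves, and every slot carrying 1 + l′ parallel edges.
module Fan (k p′ l′ : ℕ) where

  open Evolution k

  p l N : ℕ
  p = suc p′
  l = suc l′
  N = k + p

  -- inj₁ v joins vertex 1 + v to the hub 0, and inj₂ i joins vertex 1 + i to i.
  Slot : Set
  Slot = Fin N ⊎ Fin k

  edges : ℕ
  edges = (N + k) * l

  slotOf : Fin edges → Slot
  slotOf e = splitAt N (proj₁ (remQuot {N + k} l e))

  copyOf : Fin edges → Fin l
  copyOf e = proj₂ (remQuot {N + k} l e)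

  edge : Slot → Fin l → Fin edges
  edge s c = combine (join N k s) c

  slotOf-edge : ∀ s c → slotOf (edge s c) ≡ s
  slotOf-edge s c = trans (cong (splitAt N ∘ proj₁) (remQuot-combine (join N k s) c)) (splitAt-join N k s)

  copyOf-edge : ∀ s c → copyOf (edge s c) ≡ c
  copyOf-edge s c = cong proj₂ (remQuot-combine (join N k s) c)

  upper lower : Slot → Fin (suc N)
  upper (inj₁ v) = suc v
  upper (inj₂ i) = suc (i ↑ˡ p)
  lower (inj₁ v) = zero
  lower (inj₂ i) = inject₁ (i ↑ˡ p)

  -- The common name of the two slots at a vertex: vertex 1 + i is the upper end of the slots of
  -- index i. All potentials depend on a slot only through this number.
  index : Slot → ℕ
  index (inj₁ v) = toℕ v
  index (inj₂ i) = toℕ i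

  toℕ-upper : ∀ s → toℕ (upper s) ≡ suc (index s)
  toℕ-upper (inj₁ v) = refl
  toℕ-upper (inj₂ i) = cong suc (toℕ-↑ˡ i p)

  toℕ-rim-lower : ∀ i → toℕ (lower (inj₂ i)) ≡ toℕ i
  toℕ-rim-lower i = trans (toℕ-inject₁ (i ↑ˡ p)) (toℕ-↑ˡ i p)

  toℕ-lower : ∀ s → toℕ (lower s) ≤ index s
  toℕ-lower (inj₁ v) = z≤n
  toℕ-lower (inj₂ i) = ≤-reflexive (toℕ-rim-lower i)

  G : MultiGraph (suc N)
  G = record
    { m        = edges
    ; src      = λ e → upper (slotOf e)
    ; tgt      = λ e → lower (slotOf e)
    ; loopless = λ e eq → <⇒≢ (s≤s (toℕ-lower (slotOf e)))
                   (trans (cong toℕ (sym eq)) (toℕ-upper (slotOf e)))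
    }

  open Walks G
  open Trees G

  Σ-edges : (F : Slot → Fin l → ℕ) → Σᶠ (λ e → F (slotOf e) (copyOf e)) ≡
            Σᶠ (λ v → Σᶠ (F (inj₁ v))) + Σᶠ (λ i → Σᶠ (F (inj₂ i)))
  Σ-edges F = begin
    Σᶠ (λ e → F (slotOf e) (copyOf e))
      ≡⟨ Σᶠ-combine (N + k) l (λ e → F (slotOf e) (copyOf e)) ⟩
    Σᶠ {N + k} (λ s → Σᶠ {l} λ c → F (slotOf (combine s c)) (copyOf (combine s c)))
      ≡⟨ sum-cong-≗ {N + k} (λ s → sum-cong-≗ {l} λ c → cong (λ (s′ , c′) → F (splitAt N s′) c′) (remQuot-combine s c)) ⟩
    Σᶠ {N + k} (λ s → Σᶠ {l} (F (splitAt N s)))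
      ≡⟨ Σᶠ-↑ N (λ s → Σᶠ {l} (F (splitAt N s))) ⟩
    Σᶠ {N} (λ v → Σᶠ {l} (F (splitAt N (v ↑ˡ k)))) + Σᶠ {k} (λ i → Σᶠ {l} (F (splitAt N (N ↑ʳ i))))
      ≡⟨ cong₂ _+_ (sum-cong-≗ {N} (λ v → cong (Σᶠ ∘ F) (splitAt-↑ˡ N v k)))
                   (sum-cong-≗ {k} (λ i → cong (Σᶠ ∘ F) (splitAt-↑ʳ N k i))) ⟩
    Σᶠ (λ v → Σᶠ (F (inj₁ v))) + Σᶠ (λ i → Σᶠ (F (inj₂ i))) ∎
    where open ≡-Reasoning

  select : (Slot → Bool) → ℕ → Subset edges
  select d r = tabulate λ e → d (slotOf e) ∧ (toℕ (copyOf e) ≡ᵇ r)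

  ∈-select : ∀ d c s → d s ≡ true → edge s c ∈ select d (toℕ c)
  ∈-select d c s ds = ∈-tabulate _ (cong₂ _∧_ (trans (cong d (slotOf-edge s c)) ds)
    (dec-true (_ ≟ _) (cong toℕ (copyOf-edge s c))))

  ∈-select⁻ : ∀ d r {e} → e ∈ select d r → d (slotOf e) ≡ true × toℕ (copyOf e) ≡ r
  ∈-select⁻ d r e∈ = let a , b = ∧-true (∈-tabulate⁻ _ e∈) in a , ≡ᵇ-true b

  Σ-select : ∀ d {r} → r < l → (g : ℕ → ℕ) →
    Σᶠ (λ e → ⟦ lookup (select d r) e ⟧ * g (index (slotOf e))) ≡
    Σᶠ (λ v → g (toℕ v) * ⟦ d (inj₁ v) ⟧) + Σᶠ (λ i → g (toℕ i) * ⟦ d (inj₂ i) ⟧)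
  Σ-select d {r} r<l g = begin
    Σᶠ (λ e → ⟦ lookup (select d r) e ⟧ * g (index (slotOf e)))
      ≡⟨ sum-cong-≗ (λ e → trans (cong (λ b → ⟦ b ⟧ * g (index (slotOf e))) (lookup∘tabulate _ e)) (rearrange e)) ⟩
    Σᶠ (λ e → F (slotOf e) (copyOf e))
      ≡⟨ Σ-edges F ⟩
    Σᶠ (λ v → Σᶠ (F (inj₁ v))) + Σᶠ (λ i → Σᶠ (F (inj₂ i)))
      ≡⟨ cong₂ _+_ (sum-cong-≗ (λ v → Σᶠ-select l r<l (g (toℕ v) * ⟦ d (inj₁ v) ⟧)))
                   (sum-cong-≗ (λ i → Σᶠ-select l r<l (g (toℕ i) * ⟦ d (inj₂ i) ⟧))) ⟩
    _ ∎
    where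
    open ≡-Reasoning
    F : Slot → Fin l → ℕ
    F s c = g (index s) * ⟦ d s ⟧ * ⟦ toℕ c ≡ᵇ r ⟧
    rearrange : ∀ e → ⟦ d (slotOf e) ∧ (toℕ (copyOf e) ≡ᵇ r) ⟧ * g (index (slotOf e)) ≡ F (slotOf e) (copyOf e)
    rearrange e = trans (*-comm _ (g (index (slotOf e))))
      (trans (cong (g (index (slotOf e)) *_) (⟦∧⟧ (d (slotOf e)) _)) (sym (*-assoc (g (index (slotOf e))) _ _)))

  -- Vertices are named by their numbers here, so that walks can be built by induction along the
  -- rim.
  Reaches : (Slot → Bool) → Fin l → ℕ → Set
  Reaches d c j = ∀ v → toℕ v ≡ j → Walk G (select d (toℕ c)) v zero

  module _ (d : Slot → Bool) (c : Fin l) where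

    slot-walk : ∀ s → d s ≡ true → Walk G (select d (toℕ c)) (upper s) (lower s)
    slot-walk s ds = edgeWalk (edge s c) (∈-select d c s ds)
      (inj₁ (cong upper (slotOf-edge s c) , cong lower (slotOf-edge s c)))

    reach-hub : Reaches d c 0
    reach-hub zero refl = nil

    reach-spoke : ∀ {i} → (∀ v → toℕ v ≡ i → d (inj₁ v) ≡ true) → Reaches d c (suc i)
    reach-spoke used (suc v) eq = slot-walk (inj₁ v) (used v (suc-injective eq))

    rim-walk : ∀ {i u v} → i < k → (∀ j → toℕ j ≡ i → d (inj₂ j) ≡ true) →
               toℕ u ≡ suc i → toℕ v ≡ i → Walk G (select d (toℕ c)) u v
    rim-walk {i} {u} {v} i<k used u≡ v≡ = subst₂ (Walk G (select d (toℕ c)))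
      (toℕ-injective (trans (toℕ-upper (inj₂ j)) (trans (cong suc j≡) (sym u≡))))
      (toℕ-injective (trans (toℕ-rim-lower j) (trans j≡ (sym v≡))))
      (slot-walk (inj₂ j) (used j j≡))
      where
      j = fromℕ< i<k
      j≡ = toℕ-fromℕ< i<k

    vertex : ∀ i → i < k → ∃[ v ] toℕ {suc N} v ≡ i
    vertex i i<k = fromℕ< (<-≤-trans i<k k≤) , toℕ-fromℕ< _
      where k≤ = ≤-trans (m≤m+n k p) (n≤1+n N)

    reach-down : ∀ {i} → i < k → (∀ j → toℕ j ≡ i → d (inj₂ j) ≡ true) →
                 Reaches d c i → Reaches d c (suc i)
    reach-down i<k used reach u u≡ =
      let v , v≡ = vertex _ i<k in rim-walk i<k used u≡ v≡ ◅◅ reach v v≡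

    reach-up : ∀ {i} → suc i < k → (∀ j → toℕ j ≡ suc i → d (inj₂ j) ≡ true) →
               Reaches d c (suc (suc i)) → Reaches d c (suc i)
    reach-up {i} i<k used reach v v≡ = reverse (rim-walk i<k used u≡ v≡) ◅◅ reach u u≡
      where
      u = suc (fromℕ< i<k ↑ˡ p)
      u≡ : toℕ u ≡ suc (suc i)
      u≡ = cong suc (trans (toℕ-↑ˡ (fromℕ< i<k) p) (toℕ-fromℕ< i<k))

    select-connected : (∀ j → Reaches d c j) → Connected G (select d (toℕ c))
    select-connected reach = connectedVia zero λ v → reach (toℕ v) v refl

  inTree : ℕ → Slot → Bool
  inTree q (inj₁ v) = spokeUsed q (toℕ v)
  inTree q (inj₂ i) = rimUsed q (toℕ i)

  leaf-inTree : ∀ q {i} → k ≤ i → spokeUsed q i ≡ true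
  leaf-inTree q {i} k≤i = cong₂ (usesSpoke (below (state q) i))
    (above-outside (state q) (m≤n⇒m≤1+n k≤i)) (state-leaf q k≤i)

  -- A `level` vertex follows its run upwards to the last vertex, which has a spoke. A `rimUp`
  -- vertex has its own spoke, and a `spokeUp` vertex steps down the rim to a smaller index.
  tree-connected : ∀ q c → Connected G (select (inTree q) (toℕ c))
  tree-connected q c = select-connected (inTree q) c reach
    where
    -- The argument `n` bounds the remaining length of the run; links never lead past index `k` - 1.
    climb : ∀ n {i} → i < k → k ≤ i + n → ∀ {h} → state q i ≡ level h → Reaches (inTree q) c (suc i)
    climb zero {i} i<k k≤ _ = contradiction (subst (k ≤_) (+-identityʳ i) k≤) (<⇒≱ i<k)
    climb (suc n) {i} i<k k≤ {h} eq with above (state q) i in a-eq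
    ... | false = reach-spoke (inTree q) c λ { v refl →
                    cong₂ (usesSpoke (below (state q) i)) a-eq eq }
    ... | true  with above⇒ (state q) a-eq
    ...   | i<k′ , lk with linked-level (state q i) (state q (suc i)) lk
    ...     | h′ , _ , eq′ = reach-up (inTree q) c i<k′
                (λ j j≡ → subst (λ i → rimUsed q i ≡ true)
                  (sym j≡) (trans (cong (usesRim (below (state q) (suc i)) (above (state q) (suc i))) eq′) (trans (below-fan (state q) i<k′) lk)))
                (climb n i<k′ (subst (k ≤_) (+-suc i n) k≤) eq′)

    reach : ∀ j → Reaches (inTree q) c j
    reach zero    = reach-hub (inTree q) c
    reach (suc i) with i <? k
    ... | no i≮k  = reach-spoke (inTree q) c λ { v refl → leaf-inTree q (≮⇒≥ i≮k) }
    ... | yes i<k with state q i in eq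
    ...   | level h   = climb k i<k (m≤n+m k i) eq
    ...   | rimUp h   = reach-spoke (inTree q) c λ { v refl → cong (usesSpoke (below (state q) i) (above (state q) i)) eq }
    ...   | spokeUp h = reach-down (inTree q) c i<k
              (λ j j≡ → subst (λ i → rimUsed q i ≡ true)
                (sym j≡) (cong (usesRim (below (state q) i) (above (state q) i)) eq))
              (reach i)

  -- The tree weighs as much as if every index were used exactly once: the leaves do so literally,
  -- the fan by the hypothesis on `g`. Constant `g` gives the size of the tree, the heights give its
  -- weight.
  tree-sum : ∀ q {r} → r < l → (g : ℕ → ℕ) → ∑< k (λ i → g i * degreeAt q i) ≡ ∑< k g →
             Σᶠ (λ e → ⟦ lookup (select (inTree q) r) e ⟧ * g (index (slotOf e))) ≡ ∑< N g
  tree-sum q {r} r<l g fan = begin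
    _ ≡⟨ Σ-select (inTree q) r<l g ⟩
    Σᶠ {N} (S ∘ toℕ) + R
      ≡⟨ cong (_+ R) (Σᶠ-↑ k (S ∘ toℕ)) ⟩
    Σᶠ {k} (λ i → S (toℕ (i ↑ˡ p))) + Σᶠ {p} (λ j → S (toℕ (k ↑ʳ j))) + R
      ≡⟨ cong (_+ R) (cong₂ _+_ (sum-cong-≗ {k} (λ i → cong S (toℕ-↑ˡ i p)))
           (sum-cong-≗ {p} (λ j → trans (cong S (toℕ-↑ʳ k j)) (leaf j)))) ⟩
    ∑< k S + L + R
      ≡⟨ solve 3 (λ s l r → s :+ l :+ r := (s :+ r) :+ l) refl (∑< k S) L R ⟩
    ∑< k S + R + L
      ≡⟨ cong (_+ L) (∑<-distrib-+ k S (λ i → g i * ⟦ rimUsed q i ⟧)) ⟨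
    ∑< k (λ i → S i + g i * ⟦ rimUsed q i ⟧) + L
      ≡⟨ cong (_+ L) (∑<-cong k (λ i _ → sym (*-distribˡ-+ (g i) ⟦ spokeUsed q i ⟧ ⟦ rimUsed q i ⟧))) ⟩
    ∑< k (λ i → g i * degreeAt q i) + L
      ≡⟨ cong (_+ L) fan ⟩
    ∑< k g + L
      ≡⟨ cong (_+ L) (sum-cong-≗ {k} (λ i → cong g (toℕ-↑ˡ i p))) ⟨
    Σᶠ {k} (λ i → g (toℕ (i ↑ˡ p))) + L
      ≡⟨ Σᶠ-↑ k (g ∘ toℕ) ⟨
    ∑< N g ∎
    where
    open ≡-Reasoning
    S : ℕ → ℕ
    S i = g i * ⟦ spokeUsed q i ⟧
    L = Σᶠ {p} (λ j → g (toℕ (k ↑ʳ j)))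
    R = Σᶠ (λ i → g (toℕ i) * ⟦ inTree q (inj₂ i) ⟧)
    leaf : ∀ (j : Fin p) → S (k + toℕ j) ≡ g (toℕ (k ↑ʳ j))
    leaf j = trans (cong (λ b → g (k + toℕ j) * ⟦ b ⟧) (leaf-inTree q (m≤m+n k (toℕ j))))
                   (trans (*-identityʳ _) (cong g (sym (toℕ-↑ʳ k j))))

  tree-size : ∀ q {r} → r < l → ∣ select (inTree q) r ∣ ≡ N
  tree-size q {r} r<l = begin
    ∣ A ∣                                        ≡⟨ ∣∣≡Σᶠ A ⟩
    Σᶠ (λ e → ⟦ lookup A e ⟧)                    ≡⟨ sum-cong-≗ (λ e → *-identityʳ ⟦ lookup A e ⟧) ⟨
    Σᶠ (λ e → ⟦ lookup A e ⟧ * 1)                ≡⟨ tree-sum q r<l (λ _ → 1) degrees ⟩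
    ∑< N (λ _ → 1)                               ≡⟨ Σᶠ-const N 1 ⟩
    N * 1                                        ≡⟨ *-identityʳ N ⟩
    N                                            ∎
    where
    open ≡-Reasoning
    A = select (inTree q) r
    degrees : ∑< k (λ i → 1 * degreeAt q i) ≡ ∑< k (λ _ → 1)
    degrees = trans (∑<-cong k (λ i _ → *-identityˡ (degreeAt q i)))
      (trans (∑-degree q) (sym (trans (Σᶠ-const k 1) (*-identityʳ k))))

  tree-spanning : ∀ q c → IsSpanningTree G (select (inTree q) (toℕ c))
  tree-spanning q c = tree-connected q c ,
    connected⇒acyclic (tree-connected q c) (≤-reflexive (tree-size q (toℕ<n c)))

  -- Contracting the vertices 0, …, j leaves N - j other vertices.
  connected-suffix : ∀ {A} → Connected G A → ∀ j → j ≤ N →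
                     N ∸ j ≤ Σᶠ (λ e → ⟦ lookup A e ⟧ * ⟦ j ≤ᵇ index (slotOf e) ⟧)
  connected-suffix {A} conn j j≤N = crossing-bound conn κ onto _ counted
    where
    bound : ∀ v → toℕ {suc N} v ∸ j < suc (N ∸ j)
    bound v = s≤s (∸-monoˡ-≤ j (≤-pred (toℕ<n v)))
    κ : Fin (suc N) → Fin (suc (N ∸ j))
    κ v = fromℕ< (bound v)
    onto : ∀ i → ∃[ v ] κ v ≡ i
    onto i = fromℕ< i+j< , toℕ-injective (trans (toℕ-fromℕ< (bound (fromℕ< i+j<)))
               (trans (cong (_∸ j) (toℕ-fromℕ< i+j<)) (m+n∸n≡m (toℕ i) j)))
      where
      i+j< : toℕ i + j < suc N
      i+j< = s≤s (≤-trans (+-monoˡ-≤ j (≤-pred (toℕ<n i))) (≤-reflexive (m∸n+n≡m j≤N)))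
    counted : ∀ e → e ∈ A → κ (upper (slotOf e)) ≢ κ (lower (slotOf e)) →
              1 ≤ ⟦ lookup A e ⟧ * ⟦ j ≤ᵇ index (slotOf e) ⟧
    counted e e∈A cross with j ≤? index (slotOf e)
    ... | yes j≤ = *-mono-≤ (∈⇒1≤ e∈A) (≤-reflexive (cong ⟦_⟧ (sym (dec-true (j ≤? _) j≤))))
    ... | no  j≰ = contradiction (toℕ-injective (trans (collapse (upper (slotOf e)) (≤-trans (≤-reflexive (toℕ-upper (slotOf e))) (≰⇒> j≰)))
                     (sym (collapse (lower (slotOf e)) (≤-trans (toℕ-lower (slotOf e)) (<⇒≤ (≰⇒> j≰))))))) cross
      where
      collapse : ∀ v → toℕ v ≤ j → toℕ (κ v) ≡ 0
      collapse v v≤j = trans (toℕ-fromℕ< (bound v)) (m≤n⇒m∸n≡0 v≤j)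

  -- The heights form a lower certificate: `majorization` bounds the height sum of any spanning tree
  -- from below by the sum over all indices. The selected tree attains that sum and uses only edges
  -- whose weight equals the height.
  tree-minimal : ∀ q c (w : Fin edges → ℕ) →
    (∀ e → height (state q (index (slotOf e))) ≤ w e) →
    (∀ e → e ∈ select (inTree q) (toℕ c) → w e ≤ height (state q (index (slotOf e)))) →
    IsMinSpanningTree G w (select (inTree q) (toℕ c))
  tree-minimal q c w lower-bound tight = tree-spanning q c , λ T′ (conn , _) → begin
    weight G w T                             ≤⟨ Σᶠ-mono tight′ ⟩
    Σᶠ (λ e → ⟦ lookup T e ⟧ * f (index (slotOf e)))  ≡⟨ tree-sum q (toℕ<n c) f (∑-height q) ⟩
    ∑< N f                                   ≤⟨ majorization N f (height-monotone q) (λ e → ⟦ lookup T′ e ⟧) (λ e → index (slotOf e)) (connected-suffix conn) ⟩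
    Σᶠ (λ e → ⟦ lookup T′ e ⟧ * f (index (slotOf e))) ≤⟨ Σᶠ-mono (loose T′) ⟩
    weight G w T′                            ∎
    where
    open ≤-Reasoning
    T = select (inTree q) (toℕ c)
    f : ℕ → ℕ
    f i = height (state q i)
    tight′ : ∀ e → (if lookup T e then w e else 0) ≤ ⟦ lookup T e ⟧ * f (index (slotOf e))
    tight′ e with lookup T e in eq
    ... | true  = ≤-trans (tight e (lookup⇒[]= e T eq)) (≤-reflexive (sym (*-identityˡ _)))
    ... | false = z≤n
    loose : ∀ T′ e → ⟦ lookup T′ e ⟧ * f (index (slotOf e)) ≤ (if lookup T′ e then w e else 0)
    loose T′ e with lookup T′ e
    ... | true  = ≤-trans (≤-reflexive (*-identityˡ _)) (lower-bound e)
    ... | false = z≤n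

-- Cyclic use of the parallel copies and greediness

module Packing (k p′ l′ : ℕ) where
  open Fan k p′ l′
  open Evolution k
  open Walks G

  slotLoad : ℕ → Slot → ℕ
  slotLoad q (inj₁ v) = spokeLoad (state q (toℕ v))
  slotLoad q (inj₂ i) = rimLoad (state q (toℕ i))

  slotLoad-suc : ∀ q s → slotLoad (suc q) s ≡ ⟦ inTree q s ⟧ + slotLoad q s
  slotLoad-suc q (inj₁ v) = spokeLoad-next _ _ (state q (toℕ v))
  slotLoad-suc q (inj₂ i) = rimLoad-next _ _ (state q (toℕ i))

  slotLoad-mono : ∀ q s → slotLoad q s ≤ slotLoad (suc q) s
  slotLoad-mono q s = ≤-trans (m≤n+m _ ⟦ inTree q s ⟧) (≤-reflexive (sym (slotLoad-suc q s)))

  height≤slotLoad : ∀ q s → height (state q (index s)) ≤ slotLoad q s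
  height≤slotLoad q (inj₁ v) = height≤spokeLoad (state q (toℕ v))
  height≤slotLoad q (inj₂ i) = height≤rimLoad (state q (toℕ i))

  slotLoad≡height : ∀ q s → inTree q s ≡ true → slotLoad q s ≡ height (state q (index s))
  slotLoad≡height q (inj₁ v) = spokeLoad≡height (below (state q) (toℕ v)) (above (state q) (toℕ v)) (state q (toℕ v))
  slotLoad≡height q (inj₂ i) = rimLoad≡height (below (state q) (toℕ i)) (above (state q) (toℕ i)) (state q (toℕ i))

  -- The q-th fan tree is packed l times, using copy r of every edge in turn.
  tick : ℕ × ℕ → ℕ × ℕ
  tick (q , r) = if r ≡ᵇ l′ then (suc q , 0) else (q , suc r)

  clock : ℕ → ℕ × ℕ
  clock zero    = 0 , 0
  clock (suc τ) = tick (clock τ)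

  clock-sound : ∀ τ → let q , r = clock τ in r < l × τ ≡ r + q * l
  clock-sound zero    = s≤s z≤n , refl
  clock-sound (suc τ) with clock τ | clock-sound τ
  ... | q , r | r<l , τ≡ with r ≡ᵇ l′ in eq
  ...   | true  = s≤s z≤n , trans (cong suc τ≡) (cong (λ j → suc j + q * l) (≡ᵇ-true eq))
  ...   | false = s≤s (≤∧≢⇒< (≤-pred r<l) (≡ᵇ-false eq)) , cong suc τ≡

  treeAt : ℕ × ℕ → Subset edges
  treeAt (q , r) = select (inTree q) r

  packing : ℕ → Subset edges
  packing τ = treeAt (clock τ)

  -- At time `(q , r)` the copies below `r` have already had their turn in round `q`, and the others
  -- have not.
  rounds : ℕ × ℕ → ℕ → ℕ
  rounds (q , r) c = if c <ᵇ r then suc q else q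

  loadAt : ℕ × ℕ → Fin edges → ℕ
  loadAt t e = slotLoad (rounds t (toℕ (copyOf e))) (slotOf e)

  private
    <ᵇ-true : ∀ {a b} → a < b → (a <ᵇ b) ≡ true
    <ᵇ-true {a} {b} a<b = dec-true (a <? b) a<b
    <ᵇ-false : ∀ {a b} → b ≤ a → (a <ᵇ b) ≡ false
    <ᵇ-false {a} {b} b≤a = dec-false (a <? b) (≤⇒≯ b≤a)

  rounds-early : ∀ q {r c} → c < r → rounds (q , r) c ≡ suc q
  rounds-early q c<r = cong (if_then suc q else q) (<ᵇ-true c<r)

  rounds-late : ∀ q {r c} → r ≤ c → rounds (q , r) c ≡ q
  rounds-late q r≤c = cong (if_then suc q else q) (<ᵇ-false r≤c)

  rounds-tick : ∀ q r c → r < l → c < l →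
                rounds (tick (q , r)) c ≡ (if c <ᵇ suc r then suc q else q)
  rounds-tick q r c r<l c<l with r ≡ᵇ l′ in eq
  ... | true  = cong (if_then suc q else q) (sym (<ᵇ-true (subst (λ j → c < suc j) (sym (≡ᵇ-true eq)) c<l)))
  ... | false = refl

  loadAt-tick : ∀ q r → r < l → ∀ e →
                loadAt (tick (q , r)) e ≡ ⟦ lookup (treeAt (q , r)) e ⟧ + loadAt (q , r) e
  loadAt-tick q r r<l e = begin
    slotLoad (rounds (tick (q , r)) c) s        ≡⟨ cong (λ j → slotLoad j s) (rounds-tick q r c r<l (toℕ<n (copyOf e))) ⟩
    slotLoad (rounds (q , suc r) c) s           ≡⟨ advance (<-cmp c r) ⟩
    ⟦ inTree q s ∧ (c ≡ᵇ r) ⟧ + loadAt (q , r) e ≡⟨ cong (λ b → ⟦ b ⟧ + loadAt (q , r) e) (lookup∘tabulate _ e) ⟨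
    ⟦ lookup (treeAt (q , r)) e ⟧ + loadAt (q , r) e ∎
    where
    open ≡-Reasoning
    c = toℕ (copyOf e)
    s = slotOf e
    unused : c ≢ r → ⟦ inTree q s ∧ (c ≡ᵇ r) ⟧ ≡ 0
    unused c≢r = trans (⟦∧⟧ (inTree q s) _) (trans (cong (λ b → ⟦ inTree q s ⟧ * ⟦ b ⟧) (dec-false (c ≟ r) c≢r)) (*-zeroʳ ⟦ inTree q s ⟧))
    advance : Tri (c < r) (c ≡ r) (r < c) →
           slotLoad (rounds (q , suc r) c) s ≡ ⟦ inTree q s ∧ (c ≡ᵇ r) ⟧ + loadAt (q , r) e
    advance (tri< c<r c≢r _) = trans (cong (λ j → slotLoad j s) (trans (rounds-early q (m≤n⇒m≤1+n c<r)) (sym (rounds-early q c<r))))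
                              (cong (_+ loadAt (q , r) e) (sym (unused c≢r)))
    advance (tri> _ c≢r r<c) = trans (cong (λ j → slotLoad j s) (trans (rounds-late q r<c) (sym (rounds-late q (<⇒≤ r<c)))))
                              (cong (_+ loadAt (q , r) e) (sym (unused c≢r)))
    advance (tri≈ _ c≡r _) = begin
      slotLoad (rounds (q , suc r) c) s ≡⟨ cong (λ j → slotLoad j s) (rounds-early q (s≤s (≤-reflexive c≡r))) ⟩
      slotLoad (suc q) s                ≡⟨ slotLoad-suc q s ⟩
      ⟦ inTree q s ⟧ + slotLoad q s     ≡⟨ cong₂ _+_ used (cong (λ j → slotLoad j s) (rounds-late q (≤-reflexive (sym c≡r)))) ⟨
      ⟦ inTree q s ∧ (c ≡ᵇ r) ⟧ + loadAt (q , r) e ∎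
      where
      used : ⟦ inTree q s ∧ (c ≡ᵇ r) ⟧ ≡ ⟦ inTree q s ⟧
      used = trans (⟦∧⟧ (inTree q s) _) (trans (cong (λ b → ⟦ inTree q s ⟧ * ⟦ b ⟧) (dec-true (c ≟ r) c≡r)) (*-identityʳ ⟦ inTree q s ⟧))

  load≡loadAt : ∀ τ e → load G (firstTrees packing τ) e ≡ loadAt (clock τ) e
  load≡loadAt zero    e = initial (slotOf e)
    where
    initial : ∀ s → 0 ≡ slotLoad 0 s
    initial (inj₁ _) = refl
    initial (inj₂ _) = refl
  load≡loadAt (suc τ) e = begin
    (if does (e ∈? packing τ) then suc else id) (load G (firstTrees packing τ) e)
      ≡⟨ cong₂ (λ b x → (if b then suc else id) x) (does-∈? (packing τ) e) (load≡loadAt τ e) ⟩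
    (if lookup (packing τ) e then suc else id) (loadAt (clock τ) e)
      ≡⟨ count-bit (lookup (packing τ) e) ⟩
    ⟦ lookup (packing τ) e ⟧ + loadAt (clock τ) e
      ≡⟨ loadAt-tick _ _ (proj₁ (clock-sound τ)) e ⟨
    loadAt (clock (suc τ)) e ∎
    where
    open ≡-Reasoning
    count-bit : ∀ b {x} → (if b then suc else id) x ≡ ⟦ b ⟧ + x
    count-bit true  = refl
    count-bit false = refl

  -- The copy whose turn it is has completed exactly `q` rounds and every other copy at least `q`.
  -- As loads only grow, the heights of round `q` are a lower certificate on all copies, and they
  -- are exact on the edges of the new tree.
  greedy : ∀ τ → IsGreedy G (firstTrees packing τ)
  greedy zero    = []
  greedy (suc τ) = minimal ∷ greedy τ
    where
    q = proj₁ (clock τ)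
    r = proj₂ (clock τ)
    r<l = proj₁ (clock-sound τ)
    w = load G (firstTrees packing τ)
    at-least : ∀ j s → slotLoad q s ≤ slotLoad (rounds (q , r) j) s
    at-least j s with j <ᵇ r
    ... | true  = slotLoad-mono q s
    ... | false = ≤-refl
    tight : ∀ e → e ∈ select (inTree q) r → w e ≤ height (state q (index (slotOf e)))
    tight e e∈ with ∈-select⁻ (inTree q) r e∈
    ... | used , c≡r = ≤-reflexive (trans (load≡loadAt τ e)
            (trans (cong (λ j → slotLoad j (slotOf e)) (rounds-late q (≤-reflexive (sym c≡r))))
                   (slotLoad≡height q (slotOf e) used)))
    minimal : IsMinSpanningTree G w (select (inTree q) r)
    minimal = subst (λ r′ → IsMinSpanningTree G w (select (inTree q) r′)) (toℕ-fromℕ< r<l)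
      (tree-minimal q (fromℕ< r<l) w
        (λ e → ≤-trans (height≤slotLoad q (slotOf e))
                 (≤-trans (at-least (toℕ (copyOf e)) (slotOf e)) (≤-reflexive (sym (load≡loadAt τ e)))))
        (λ e e∈ → tight e (subst (λ r′ → e ∈ select (inTree q) r′) (toℕ-fromℕ< r<l) e∈)))

  firstCopy lastCopy : Fin l
  firstCopy = zero
  lastCopy  = fromℕ< (n<1+n l′)

  -- `Q` is τ / `l` rounded up. The first copy has completed `Q` rounds and the last one at most
  -- `Q`, so a heavy edge is taken from the first copy and a light edge from the last without loss
  -- from an unfinished round.
  record Extremes (τ : ℕ) : Set where
    field
      Q      : ℕ
      1≤Q    : 1 ≤ Q
      τ≤Ql   : τ ≤ Q * l
      first≥ : ∀ s → slotLoad Q s ≤ load G (firstTrees packing τ) (edge s firstCopy)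
      last≤  : ∀ s → load G (firstTrees packing τ) (edge s lastCopy) ≤ slotLoad Q s

  load-edge : ∀ τ s c → load G (firstTrees packing τ) (edge s c) ≡ slotLoad (rounds (clock τ) (toℕ c)) s
  load-edge τ s c = trans (load≡loadAt τ (edge s c))
    (cong₂ slotLoad (cong (rounds (clock τ) ∘ toℕ) (copyOf-edge s c)) (slotOf-edge s c))

  extremes : ∀ τ → 1 ≤ τ → Extremes τ
  extremes τ 1≤τ with clock τ | clock-sound τ | load-edge τ
  ... | zero  , zero  | _ , refl | _ = contradiction 1≤τ λ ()
  ... | suc q , zero  | _ , τ≡   | at = record
    { Q = suc q ; 1≤Q = s≤s z≤n ; τ≤Ql = ≤-reflexive τ≡
    ; first≥ = λ s → ≤-reflexive (sym (at s firstCopy))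
    ; last≤  = λ s → ≤-reflexive (at s lastCopy) }
  ... | q , suc r | r<l , τ≡ | at = record
    { Q = suc q ; 1≤Q = s≤s z≤n ; τ≤Ql = ≤-trans (≤-reflexive τ≡) (+-monoˡ-≤ (q * l) (<⇒≤ r<l))
    ; first≥ = λ s → ≤-reflexive (sym (at s firstCopy))
    ; last≤  = λ s → ≤-trans (≤-reflexive (trans (at s lastCopy)
        (cong (λ j → slotLoad j s) (rounds-late q (≤-trans (≤-pred r<l) (≤-reflexive (sym (toℕ-fromℕ< (n<1+n l′)))))))))
        (slotLoad-mono q s) }

  leaf₀ : Fin p
  leaf₀ = zero

  leafSlot : Slot
  leafSlot = inj₁ (k ↑ʳ leaf₀)

  leaf-load : ∀ τ → 1 ≤ τ → 1 ≤ load G (firstTrees packing τ) (edge leafSlot firstCopy)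
  leaf-load τ 1≤τ = ≤-trans 1≤Q (≤-trans (≤-reflexive (sym load≡Q)) (first≥ leafSlot))
    where
    open Extremes (extremes τ 1≤τ)
    load≡Q : slotLoad Q leafSlot ≡ Q
    load≡Q = cong spokeLoad (state-leaf Q (≤-trans (m≤m+n k 0) (≤-reflexive (sym (toℕ-↑ʳ k leaf₀)))))

  slotsAt : ∀ q i → i < k → ∃[ v ] ∃[ j ] index (inj₁ v) ≡ i × index (inj₂ j) ≡ i ×
            total (state q i) ≡ slotLoad q (inj₁ v) + slotLoad q (inj₂ j)
  slotsAt q i i<k = fromℕ< i<k ↑ˡ p , fromℕ< i<k , v≡ , j≡ ,
    trans (total≡loads (state q i)) (sym (cong₂ _+_ (cong (spokeLoad ∘ state q) v≡) (cong (rimLoad ∘ state q) j≡)))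
    where
    j≡ = toℕ-fromℕ< i<k
    v≡ = trans (toℕ-↑ˡ (fromℕ< i<k) p) j≡

  heavySlot : ∀ q i → i < k → ∃[ s ] index s ≡ i × total (state q i) ≤ 2 * slotLoad q s
  heavySlot q i i<k with slotsAt q i i<k
  ... | v , j , v≡ , j≡ , total≡ with ≤-total (slotLoad q (inj₁ v)) (slotLoad q (inj₂ j))
  ...   | inj₁ a≤b = inj₂ j , j≡ , ≤-trans (≤-reflexive total≡) (+-mono-≤ a≤b (m≤m+n _ 0))
  ...   | inj₂ b≤a = inj₁ v , v≡ , ≤-trans (≤-reflexive total≡) (+-monoʳ-≤ _ (≤-trans b≤a (m≤m+n _ 0)))

  lightSlot : ∀ q i → i < k → ∃[ s ] index s ≡ i × 2 * slotLoad q s ≤ total (state q i)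
  lightSlot q i i<k with slotsAt q i i<k
  ... | v , j , v≡ , j≡ , total≡ with ≤-total (slotLoad q (inj₁ v)) (slotLoad q (inj₂ j))
  ...   | inj₁ a≤b = inj₁ v , v≡ , ≤-trans (+-monoʳ-≤ _ (≤-trans (≤-reflexive (+-identityʳ _)) a≤b)) (≤-reflexive (sym total≡))
  ...   | inj₂ b≤a = inj₂ j , j≡ , ≤-trans (+-mono-≤ b≤a (≤-reflexive (+-identityʳ _))) (≤-reflexive (sym total≡))

  -- Passes from totals to single edges: the heavier edge at the last fan vertex carries at least
  -- half of its total, the lighter edge at the first at most half. This is the origin of the
  -- factors 2.
  uneven : ∀ {t} → k ≡ suc t → 1 ≤ t → ∀ τ → 1 ≤ τ →
    ∃[ Q ] 1 ≤ Q × τ ≤ Q * l × ∃[ e ] ∃[ f ] index (slotOf e) < k × index (slotOf f) < k ×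
    let L = load G (firstTrees packing τ) in
    (t + 2 * L f ≤ 2 * L e) ⊎ (Q + 2 * ranks * (2 * L f) ≤ 2 * ranks * (2 * L e))
  uneven {t} refl 1≤t τ 1≤τ =
    let top , top≡ , heavy = heavySlot Q t ≤-refl
        bot , bot≡ , light = lightSlot Q 0 (s≤s z≤n)
        L≥ = ≤-trans heavy (*-monoʳ-≤ 2 (first≥ top))
        L≤ = ≤-trans (*-monoʳ-≤ 2 (last≤ bot)) light
    in Q , 1≤Q , τ≤Ql , edge top firstCopy , edge bot lastCopy ,
       in-fan top firstCopy (≤-trans (s≤s (≤-reflexive top≡)) ≤-refl) ,
       in-fan bot lastCopy (≤-trans (s≤s (≤-reflexive bot≡)) (s≤s z≤n)) ,
       Sum.map (λ d → ≤-trans (+-monoʳ-≤ t L≤) (≤-trans d L≥))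
               (λ d → ≤-trans (+-monoʳ-≤ Q (*-monoʳ-≤ (2 * ranks) L≤)) (≤-trans d (*-monoʳ-≤ (2 * ranks) L≥)))
               (spread refl 1≤t Q)
    where
    open Extremes (extremes τ 1≤τ)
    in-fan : ∀ s c → index s < k → index (slotOf (edge s c)) < k
    in-fan s c = subst (λ s → index s < k) (sym (slotOf-edge s c))

  -- Edge-disjoint connected subgraphs and the minimum cut

  isSpoke : Slot → Bool
  isSpoke (inj₁ _) = true
  isSpoke (inj₂ _) = false

  -- The rim path down to the hub, completed by the leaf edges so that it spans. Away from the
  -- leaves it is disjoint from the star of spokes.
  isRim : Slot → Bool
  isRim (inj₁ v) = k ≤ᵇ toℕ v
  isRim (inj₂ _) = true

  spokes-connected : ∀ c → Connected G (select isSpoke (toℕ c))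
  spokes-connected c = select-connected isSpoke c λ where
    zero    → reach-hub isSpoke c
    (suc j) → reach-spoke isSpoke c λ _ _ → refl

  rims-connected : ∀ c → Connected G (select isRim (toℕ c))
  rims-connected c = select-connected isRim c reach
    where
    reach : ∀ j → Reaches isRim c j
    reach zero    = reach-hub isRim c
    reach (suc j) with j <? k
    ... | yes j<k = reach-down isRim c j<k (λ _ _ → refl) (reach j)
    ... | no  j≮k = reach-spoke isRim c λ v v≡j → dec-true (k ≤? toℕ v) (subst (k ≤_) (sym v≡j) (≮⇒≥ j≮k))

  isCopy : Fin l → Fin edges → Bool
  isCopy c e = toℕ c ≡ᵇ toℕ (copyOf e)

  copies-bound : ∀ y (χ : Fin edges → ℕ) → (∀ c → y ≤ Σᶠ (λ e → χ e * ⟦ isCopy c e ⟧)) → l * y ≤ Σᶠ χ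
  copies-bound y χ y≤ = begin
    l * y                                       ≡⟨ Σᶠ-const l y ⟨
    Σᶠ {l} (λ _ → y)                            ≤⟨ Σᶠ-mono y≤ ⟩
    Σᶠ (λ c → Σᶠ (λ e → χ e * ⟦ isCopy c e ⟧))  ≡⟨ ∑-comm (λ c e → χ e * ⟦ isCopy c e ⟧) ⟩
    Σᶠ (λ e → Σᶠ (λ c → χ e * ⟦ isCopy c e ⟧))  ≡⟨ sum-cong-≗ (λ e → Σᶠ-select l (toℕ<n (copyOf e)) (χ e)) ⟩
    Σᶠ χ                                        ∎
    where open ≤-Reasoning

  isCopy-true : ∀ {c e} → toℕ (copyOf e) ≡ toℕ c → ⟦ isCopy c e ⟧ ≡ 1
  isCopy-true {c} {e} eq = cong ⟦_⟧ (dec-true (toℕ c ≟ toℕ (copyOf e)) (sym eq))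

  -- The copies of the star are `l` edge-disjoint connected spanning subgraphs, and a cut must meet
  -- each of them.
  cut≥ : ∀ F → ¬ Connected G (∁ F) → l ≤ ∣ F ∣
  cut≥ F disconnected = ≤-trans (≤-reflexive (sym (*-identityʳ l)))
    (≤-trans (copies-bound 1 _ hit) (≤-reflexive (sym (∣∣≡Σᶠ F))))
    where
    hit : ∀ c → 1 ≤ Σᶠ (λ e → ⟦ lookup F e ⟧ * ⟦ isCopy c e ⟧)
    hit c with any? (λ e → e ∈? F ×-dec e ∈? select isSpoke (toℕ c))
    ... | yes (e , e∈F , e∈c) = ≤-trans
            (*-mono-≤ (∈⇒1≤ e∈F) (≤-reflexive (sym (isCopy-true (proj₂ (∈-select⁻ isSpoke (toℕ c) e∈c))))))
            (term≤Σᶠ (λ e → ⟦ lookup F e ⟧ * ⟦ isCopy c e ⟧) e)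
    ... | no  none = contradiction
            (λ u v → walk-map (λ e e∈ j → edgeWalk e (x∉p⇒x∈∁p (λ e∈F → none (e , e∈F , e∈))) j)
                       (spokes-connected c u v))
            disconnected

  isLeafEdge : Slot → Bool
  isLeafEdge (inj₁ v) = toℕ v ≡ᵇ k
  isLeafEdge (inj₂ _) = false

  leafCut : Subset edges
  leafCut = tabulate (isLeafEdge ∘ slotOf)

  leafCut-size : ∣ leafCut ∣ ≡ l
  leafCut-size = begin
    ∣ leafCut ∣                                ≡⟨ ∣∣≡Σᶠ leafCut ⟩
    Σᶠ (λ e → ⟦ lookup leafCut e ⟧)            ≡⟨ sum-cong-≗ (λ e → cong ⟦_⟧ (lookup∘tabulate (isLeafEdge ∘ slotOf) e)) ⟩
    Σᶠ (λ e → ⟦ isLeafEdge (slotOf e) ⟧)       ≡⟨ Σ-edges (λ s _ → ⟦ isLeafEdge s ⟧) ⟩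
    Σᶠ {N} (λ v → Σᶠ {l} (λ _ → ⟦ toℕ v ≡ᵇ k ⟧)) + Σᶠ {k} (λ _ → Σᶠ {l} (λ _ → 0))
      ≡⟨ cong₂ _+_ (trans (sum-cong-≗ {N} (λ v → Σᶠ-const l ⟦ toℕ v ≡ᵇ k ⟧)) (Σᶠ-select N k<N l))
                   (Σᶠ-zero {k} (λ _ → Σᶠ-zero {l} (λ _ → refl))) ⟩
    l + 0                                      ≡⟨ +-identityʳ l ⟩
    l                                          ∎
    where
    open ≡-Reasoning
    k<N : k < N
    k<N = m<m+n k (s≤s z≤n)

  leafCut-cuts : ¬ Connected G (∁ leafCut)
  leafCut-cuts conn = leave (conn (suc leaf) zero) refl
    where
    leaf : Fin N
    leaf = k ↑ʳ leaf₀
    leaf≡k : toℕ leaf ≡ k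
    leaf≡k = trans (toℕ-↑ʳ k leaf₀) (+-identityʳ k)
    not-rim : ∀ i → k ≢ toℕ {k} i
    not-rim i eq = <⇒≢ (toℕ<n i) (sym eq)
    incident : ∀ s → upper s ≡ suc leaf ⊎ lower s ≡ suc leaf → isLeafEdge s ≡ true
    incident (inj₁ v) (inj₁ refl) = dec-true (toℕ v ≟ k) leaf≡k
    incident (inj₂ i) (inj₁ eq) = contradiction
      (trans (sym leaf≡k) (suc-injective (trans (sym (cong toℕ eq)) (toℕ-upper (inj₂ i))))) (not-rim i)
    incident (inj₂ i) (inj₂ eq) = contradiction
      (trans (sym (toℕ-rim-lower i)) (trans (cong toℕ eq) (cong suc leaf≡k)))
      (<⇒≢ (<-trans (toℕ<n i) (n<1+n k)))
    leave : ∀ {u} → Walk G (∁ leafCut) u zero → u ≢ suc leaf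
    leave nil ()
    leave (step e e∈ j _) refl = x∈∁p⇒x∉p e∈ (∈-tabulate _ (incident (slotOf e) (ends j)))
      where
      ends : ∀ {v} → Joins G e (suc leaf) v → upper (slotOf e) ≡ suc leaf ⊎ lower (slotOf e) ≡ suc leaf
      ends (inj₁ (eq , _)) = inj₁ eq
      ends (inj₂ (_ , eq)) = inj₂ eq

  minCut : IsMinCutValue G l
  minCut = (leafCut , leafCut-size , leafCut-cuts) , cut≥

-- Partition values and ideal loads

toℚᵘ-/ : ∀ a r .{{_ : NonZero r}} → toℚᵘ (pos a / r) ≃ (pos a ℚᵘ./ r)
toℚᵘ-/ a (suc r) = ℚ.toℚᵘ-fromℚᵘ (mkℚᵘ (pos a) r)

/-≤ : ∀ a c r s .{{_ : NonZero r}} .{{_ : NonZero s}} → a * s ≤ c * r → pos a / r ℚ.≤ pos c / s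
/-≤ a c (suc r) (suc s) as≤cr = ℚ.toℚᵘ-cancel-≤ (ℚᵘ.≤-respˡ-≃ (ℚᵘ.≃-sym (toℚᵘ-/ a (suc r)))
  (ℚᵘ.≤-respʳ-≃ (ℚᵘ.≃-sym (toℚᵘ-/ c (suc s)))
    (*≤* (subst₂ ℤ._≤_ (ℤ.pos-* a (suc s)) (ℤ.pos-* c (suc r)) (ℤ.+≤+ as≤cr)))))

/-≤⁻ : ∀ a c r s .{{_ : NonZero r}} .{{_ : NonZero s}} → pos a / r ℚ.≤ pos c / s → a * s ≤ c * r
/-≤⁻ a c (suc r) (suc s) le with ℚᵘ.≤-respˡ-≃ (toℚᵘ-/ a (suc r)) (ℚᵘ.≤-respʳ-≃ (toℚᵘ-/ c (suc s)) (ℚ.toℚᵘ-mono-≤ le))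
... | *≤* as≤cr = ℤ.drop‿+≤+ (subst₂ ℤ._≤_ (sym (ℤ.pos-* a (suc s))) (sym (ℤ.pos-* c (suc r))) as≤cr)

/-≡ : ∀ a c r s .{{_ : NonZero r}} .{{_ : NonZero s}} → a * s ≡ c * r → pos a / r ≡ pos c / s
/-≡ a c r s eq = ℚ.≤-antisym (/-≤ a c r s (≤-reflexive eq)) (/-≤ c a s r (≤-reflexive (sym eq)))

/-* : ∀ a c r s .{{_ : NonZero r}} .{{_ : NonZero s}} .{{_ : NonZero (r * s)}} →
      (pos a / r) ℚ.* (pos c / s) ≡ pos (a * c) / (r * s)
/-* a c (suc r) (suc s) = ℚ.toℚᵘ-injective (ℚᵘ.≃-trans (ℚ.toℚᵘ-homo-* (pos a / suc r) (pos c / suc s))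
  (ℚᵘ.≃-trans (ℚᵘ.*-cong (toℚᵘ-/ a (suc r)) (toℚᵘ-/ c (suc s)))
    (ℚᵘ.≃-trans (ℚᵘ.≃-reflexive (cong (λ z → mkℚᵘ z (s + r * suc s)) (sym (ℤ.pos-* a c))))
      (ℚᵘ.≃-sym (toℚᵘ-/ (a * c) (suc r * suc s))))))

fromℕ-nonZero : ∀ {x : ℚ} y .{{_ : NonZero y}} → x ≡ fromℕ y → ℚ.NonZero x
fromℕ-nonZero (suc y) x≡ = ℚ.≢-nonZero λ x≡0 →
  contradiction (/-≤⁻ (suc y) 0 1 1 (ℚ.≤-reflexive (trans (sym x≡) x≡0))) λ ()

1/fromℕ : ∀ {x : ℚ} .{{_ : ℚ.NonZero x}} y .{{_ : NonZero y}} → x ≡ fromℕ y → 1ℤ / y ≡ 1/ x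
1/fromℕ {x} (suc y) x≡ = begin
  1ℤ / suc y                        ≡⟨ ℚ.*-identityˡ (1ℤ / suc y) ⟨
  1ℚ ℚ.* (1ℤ / suc y)               ≡⟨ cong (ℚ._* (1ℤ / suc y)) (ℚ.*-inverseˡ x) ⟨
  1/ x ℚ.* x ℚ.* (1ℤ / suc y)       ≡⟨ ℚ.*-assoc (1/ x) x (1ℤ / suc y) ⟩
  1/ x ℚ.* (x ℚ.* (1ℤ / suc y))     ≡⟨ cong (1/ x ℚ.*_) unit ⟩
  1/ x ℚ.* 1ℚ                       ≡⟨ ℚ.*-identityʳ (1/ x) ⟩
  1/ x                              ∎
  where
  open ≡-Reasoning
  unit : x ℚ.* (1ℤ / suc y) ≡ 1ℚ
  unit = trans (cong (ℚ._* (1ℤ / suc y)) x≡) (trans (/-* (suc y) 1 1 (suc y))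
    (/-≡ (suc y * 1) 1 (1 * suc y) 1 (trans (*-identityʳ (suc y * 1)) (trans (*-comm (suc y) 1) (sym (*-identityˡ (1 * suc y)))))))

does⇒ : ∀ {A : Set} (a? : Dec A) → does a? ≡ true → A
does⇒ (yes a) _ = a

singleton-size : ∀ {n} {S : Subset n} x → x ∈ S → (∀ {y} → y ∈ S → y ≡ x) → ∣ S ∣ ≡ 1
singleton-size {S = S} x x∈S only = trans (cong ∣_∣ S≡) (∣⁅x⁆∣≡1 x)
  where
  S≡ : S ≡ ⁅ x ⁆
  S≡ = ⊆-antisym (λ y∈S → subst (_∈ ⁅ x ⁆) (sym (only y∈S)) (x∈⁅x⁆ x))
                 (λ y∈ → subst (_∈ S) (sym (x∈⁅y⁆⇒x≡y x y∈)) x∈S)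

module Partitions {n : ℕ} (G : MultiGraph n) where
  open MultiGraph G renaming (m to edges)
  open Partition

  ∈-classSet : ∀ {S} (P : Partition G S) {v i} → v ∈ S → class P v ≡ i → v ∈ classSet P i
  ∈-classSet P v∈S eq = ∈-tabulate _ (dec-true (_ ∈? _ ×-dec _ Fin.≟ _) (v∈S , eq))

  ∈-classSet⁻ : ∀ {S} (P : Partition G S) {v i} → v ∈ classSet P i → v ∈ S × class P v ≡ i
  ∈-classSet⁻ P v∈ = does⇒ (_ ∈? _ ×-dec _ Fin.≟ _) (∈-tabulate⁻ _ v∈)

  ∈-crossing : ∀ {S} (P : Partition G S) {e} → Crosses P e → e ∈ crossing P
  ∈-crossing P {e} cr = ∈-tabulate (does ∘ crosses? P) (dec-true (crosses? P e) cr)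

  ∣crossing∣≤ : ∀ {S} (P : Partition G S) (χ : Fin edges → ℕ) → (∀ e → Crosses P e → 1 ≤ χ e) →
                ∣ crossing P ∣ ≤ Σᶠ χ
  ∣crossing∣≤ P χ χ≥1 = ≤-trans (≤-reflexive (∣∣≡Σᶠ (crossing P))) (Σᶠ-mono le)
    where
    le : ∀ e → ⟦ lookup (crossing P) e ⟧ ≤ χ e
    le e with lookup (crossing P) e in eq
    ... | false = z≤n
    ... | true  = χ≥1 e (does⇒ (crosses? P e) (trans (sym (lookup∘tabulate (does ∘ crosses? P) e)) eq))

  value≡ : ∀ {S} (P : Partition G S) y → ∣ crossing P ∣ ≡ y * r P → value P ≡ fromℕ y
  value≡ P y eq = /-≡ ∣ crossing P ∣ y (r P) 1 (trans (*-identityʳ ∣ crossing P ∣) eq)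

  -- Both minimum values, `l` and `2 * l`, are integers, so minimality becomes a comparison of
  -- natural numbers.
  value-min : ∀ {S} (P : Partition G S) y → ∣ crossing P ∣ ≡ y * r P →
              (∀ (P′ : Partition G S) → y * r P′ ≤ ∣ crossing P′ ∣) → IsMinPartition G P
  value-min P y eq bound P′ = ℚ.≤-trans (ℚ.≤-reflexive (value≡ P y eq))
    (/-≤ y ∣ crossing P′ ∣ 1 (r P′) (≤-trans (bound P′) (≤-reflexive (sym (*-identityʳ ∣ crossing P′ ∣)))))

module Ideal (k p′ l′ : ℕ) where
  open Fan k p′ l′
  open Packing k p′ l′
  open Walks G
  open Partitions G
  open Partition

  -- `crossing-bound` needs a colouring of all vertices. Those outside `S` get the class of the hub,
  -- so that leaf edges leaving `S` do not cross.
  extend : ∀ {S} (P : Partition G S) → Fin (suc N) → Fin (suc (r P))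
  extend {S} P v with v ∈? S
  ... | yes _ = class P v
  ... | no  _ = class P zero

  extend-in : ∀ {S} (P : Partition G S) {v} → v ∈ S → extend P v ≡ class P v
  extend-in {S} P {v} v∈S with v ∈? S
  ... | yes _   = refl
  ... | no  v∉S = contradiction v∈S v∉S

  extend-out : ∀ {S} (P : Partition G S) {v} → v ∉ S → extend P v ≡ class P zero
  extend-out {S} P {v} v∉S with v ∈? S
  ... | yes v∈S = contradiction v∈S v∉S
  ... | no  _   = refl

  spokes rims : Slot → ℕ
  spokes s = ⟦ isSpoke s ⟧
  rims   s = ⟦ not (isSpoke s) ⟧

  -- The easy half of the tree-packing theorem: each of the `l` copies of a connected subgraph
  -- crosses the partition at least `r P` times. The factor `χ` restricts the count to one kind of
  -- slot, so that bounds for spokes and rims can be added.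
  cross-bound : ∀ {S} (P : Partition G S) (d : Slot → Bool) (χ : Slot → ℕ) →
    (∀ e → d (slotOf e) ≡ true → extend P (upper (slotOf e)) ≢ extend P (lower (slotOf e)) →
       Crosses P e × 1 ≤ χ (slotOf e)) →
    (∀ c → Connected G (select d (toℕ c))) →
    l * r P ≤ Σᶠ (λ e → ⟦ lookup (crossing P) e ⟧ * χ (slotOf e))
  cross-bound P d χ crosses conn = copies-bound (r P) _ λ c →
    crossing-bound (conn c) (extend P)
      (λ i → let v , v∈S , v≡ = inhabited P i in v , trans (extend-in P v∈S) v≡) _
      λ e e∈ ≢ → let used , copy≡ = ∈-select⁻ d (toℕ c) e∈
                     cr , χ≥1 = crosses e used ≢ in
        *-mono-≤ (*-mono-≤ (∈⇒1≤ (∈-crossing P cr)) χ≥1) (≤-reflexive (sym (isCopy-true copy≡)))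

  spoke-crosses : ∀ {S} (P : Partition G S) → zero ∈ S → ∀ e → isSpoke (slotOf e) ≡ true →
    extend P (upper (slotOf e)) ≢ extend P (lower (slotOf e)) → Crosses P e × 1 ≤ spokes (slotOf e)
  spoke-crosses {S} P z∈S e used ≢ with slotOf e
  ... | inj₁ v with suc v ∈? S
  ...   | yes v∈S = (v∈S , z∈S , λ eq → ≢ (trans eq (sym (extend-in P z∈S)))) , ≤-refl
  ...   | no  v∉S = contradiction (sym (extend-in P z∈S)) ≢

  spoke-bound : ∀ {S} (P : Partition G S) → zero ∈ S →
                l * r P ≤ Σᶠ (λ e → ⟦ lookup (crossing P) e ⟧ * spokes (slotOf e))
  spoke-bound P z∈S = cross-bound P isSpoke spokes (spoke-crosses P z∈S) spokes-connected

  rim-crosses : ∀ {S} (P : Partition G S) → zero ∈ S →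
    (∀ {v} → toℕ v ≤ k → v ∈ S) → (∀ {v} → k < toℕ v → v ∉ S) → ∀ e → isRim (slotOf e) ≡ true →
    extend P (upper (slotOf e)) ≢ extend P (lower (slotOf e)) → Crosses P e × 1 ≤ rims (slotOf e)
  rim-crosses P z∈S inside outside e used ≢ with slotOf e
  ... | inj₁ v = contradiction (trans (extend-out P (outside (s≤s (does⇒ (k ≤? toℕ v) used)))) (sym (extend-in P z∈S))) ≢
  ... | inj₂ i = (u∈S , v∈S , λ eq → ≢ (trans (extend-in P u∈S) (trans eq (sym (extend-in P v∈S))))) , ≤-refl
    where
    u∈S = inside (≤-trans (≤-reflexive (toℕ-upper (inj₂ i))) (toℕ<n i))
    v∈S = inside (≤-trans (toℕ-lower (inj₂ i)) (<⇒≤ (toℕ<n i)))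

  full-bound : (P : Partition G full) → l * r P ≤ ∣ crossing P ∣
  full-bound P = ≤-trans (spoke-bound P ∈⊤)
    (≤-trans (Σᶠ-mono (λ e → ≤-trans (*-monoʳ-≤ ⟦ lookup (crossing P) e ⟧ (bit (isSpoke (slotOf e)))) (≤-reflexive (*-identityʳ _))))
             (≤-reflexive (sym (∣∣≡Σᶠ (crossing P)))))
    where
    bit : ∀ b → ⟦ b ⟧ ≤ 1
    bit false = z≤n
    bit true  = ≤-refl

  -- Spokes and rim edges are disjoint, and each kind alone connects the hub and the fan in every
  -- copy. Together they give 2 `l` crossings for each class beyond the first.
  core-bound : ∀ {S} (P : Partition G S) → zero ∈ S →
    (∀ {v} → toℕ v ≤ k → v ∈ S) → (∀ {v} → k < toℕ v → v ∉ S) → (2 * l) * r P ≤ ∣ crossing P ∣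
  core-bound P z∈S inside outside = begin
    (2 * l) * r P       ≡⟨ trans (*-assoc 2 l (r P)) (cong (λ x → l * r P + x) (+-identityʳ (l * r P))) ⟩
    l * r P + l * r P   ≤⟨ +-mono-≤ (spoke-bound P z∈S)
                            (cross-bound P isRim rims (rim-crosses P z∈S inside outside) rims-connected) ⟩
    Σᶠ (λ e → χ e * spokes (slotOf e)) + Σᶠ (λ e → χ e * rims (slotOf e))
      ≡⟨ ∑-distrib-+ (λ e → χ e * spokes (slotOf e)) _ ⟨
    Σᶠ (λ e → χ e * spokes (slotOf e) + χ e * rims (slotOf e))
      ≡⟨ sum-cong-≗ (λ e → trans (sym (*-distribˡ-+ (χ e) (spokes (slotOf e)) _)) (trans (cong (χ e *_) (one (slotOf e))) (*-identityʳ (χ e)))) ⟩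
    Σᶠ χ                ≡⟨ ∣∣≡Σᶠ (crossing P) ⟨
    ∣ crossing P ∣      ∎
    where
    open ≤-Reasoning
    χ : Fin edges → ℕ
    χ e = ⟦ lookup (crossing P) e ⟧
    one : ∀ s → spokes s + rims s ≡ 1
    one (inj₁ _) = refl
    one (inj₂ _) = refl

  leafClass : Fin (suc N) → Fin (suc p)
  leafClass zero    = zero
  leafClass (suc v) = [ (λ _ → zero) , suc ]′ (splitAt k v)

  leafClass-leaf : ∀ j → leafClass (suc (k ↑ʳ j)) ≡ suc j
  leafClass-leaf j = cong [ (λ _ → zero) , suc ]′ (splitAt-↑ʳ k p j)

  leafClass-core : ∀ {v} → toℕ v ≤ k → leafClass v ≡ zero
  leafClass-core {zero}  _ = refl
  leafClass-core {suc v} v<k with splitAt k v in eq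
  ... | inj₁ _ = refl
  ... | inj₂ j = contradiction (≤-trans (m≤m+n k (toℕ j))
                   (≤-reflexive (trans (sym (toℕ-↑ʳ k j)) (cong toℕ (splitAt⁻¹-↑ʳ eq))))) (<⇒≱ v<k)

  leafClass-zero⁻ : ∀ {v} → leafClass v ≡ zero → toℕ v ≤ k
  leafClass-zero⁻ {zero}  _ = z≤n
  leafClass-zero⁻ {suc v} eq with splitAt k v in split≡
  ... | inj₁ i = ≤-trans (s≤s (≤-reflexive (trans (cong toℕ (sym (splitAt⁻¹-↑ˡ split≡))) (toℕ-↑ˡ i p)))) (toℕ<n i)

  leafClass-suc⁻ : ∀ {v j} → leafClass v ≡ suc j → v ≡ suc (k ↑ʳ j)
  leafClass-suc⁻ {suc v} eq with splitAt k v in split≡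
  leafClass-suc⁻ {suc v} refl | inj₂ j = cong suc (sym (splitAt⁻¹-↑ʳ split≡))

  leaves : Partition G full
  leaves = record
    { r         = p
    ; class     = leafClass
    ; inhabited = λ { zero    → zero , ∈⊤ , refl
                    ; (suc j) → suc (k ↑ʳ j) , ∈⊤ , leafClass-leaf j }
    }

  isLeafSpoke : Slot → Bool
  isLeafSpoke (inj₁ v) = k ≤ᵇ toℕ v
  isLeafSpoke (inj₂ _) = false

  leaf-crosses : ∀ e → Crosses leaves e → isLeafSpoke (slotOf e) ≡ true
  leaf-crosses e (_ , _ , ≢) with slotOf e
  ... | inj₁ v = dec-true (k ≤? toℕ v) (≮⇒≥ λ v<k → ≢ (leafClass-core {suc v} v<k))
  ... | inj₂ i = contradiction (trans (leafClass-core (≤-trans (≤-reflexive (toℕ-upper (inj₂ i))) (toℕ<n i)))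
                   (sym (leafClass-core {lower (inj₂ i)} (≤-trans (toℕ-lower (inj₂ i)) (<⇒≤ (toℕ<n i)))))) ≢

  -- Only leaf edges can cross, which gives the upper bound; the lower bound is the one valid for
  -- every partition.
  leaf-crossing : ∣ crossing leaves ∣ ≡ l * p
  leaf-crossing = ≤-antisym (≤-trans (∣crossing∣≤ leaves (λ e → ⟦ isLeafSpoke (slotOf e) ⟧)
      (λ e cr → ≤-reflexive (cong ⟦_⟧ (sym (leaf-crosses e cr)))))
    (≤-reflexive count-leaves)) (full-bound leaves)
    where
    open ≡-Reasoning
    count-leaves : Σᶠ (λ e → ⟦ isLeafSpoke (slotOf e) ⟧) ≡ l * p
    count-leaves = begin
      _ ≡⟨ Σ-edges (λ s _ → ⟦ isLeafSpoke s ⟧) ⟩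
      Σᶠ {N} (λ v → Σᶠ {l} (λ _ → ⟦ k ≤ᵇ toℕ v ⟧)) + Σᶠ {k} (λ _ → Σᶠ {l} (λ _ → 0))
        ≡⟨ cong₂ _+_ (trans (sum-cong-≗ {N} (λ v → Σᶠ-const l ⟦ k ≤ᵇ toℕ v ⟧)) (Σᶠ-↑ k (λ v → l * ⟦ k ≤ᵇ toℕ v ⟧)))
                     (Σᶠ-zero {k} (λ _ → Σᶠ-zero {l} (λ _ → refl))) ⟩
      Σᶠ {k} (λ i → l * ⟦ k ≤ᵇ toℕ (i ↑ˡ p) ⟧) + Σᶠ {p} (λ j → l * ⟦ k ≤ᵇ toℕ (k ↑ʳ j) ⟧) + 0
        ≡⟨ cong (_+ 0) (cong₂ _+_
             (Σᶠ-zero {k} (λ i → trans (cong (λ b → l * ⟦ b ⟧) (dec-false (k ≤? toℕ (i ↑ˡ p)) (<⇒≱ (subst (_< k) (sym (toℕ-↑ˡ i p)) (toℕ<n i))))) (*-zeroʳ l)))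
             (trans (sum-cong-≗ {p} (λ j → trans (cong (λ b → l * ⟦ b ⟧) (dec-true (k ≤? toℕ (k ↑ʳ j)) (subst (k ≤_) (sym (toℕ-↑ʳ k j)) (m≤m+n k (toℕ j))))) (*-identityʳ l)))
                    (Σᶠ-const p l))) ⟩
      0 + p * l + 0 ≡⟨ +-identityʳ (p * l) ⟩
      p * l         ≡⟨ *-comm p l ⟩
      l * p         ∎

  isFan : Slot → Bool
  isFan s = index s <ᵇ k

  ideal : Fin edges → ℚ
  ideal e = if isFan (slotOf e) then 1ℤ / (2 * l) else 1ℤ / l

  ideal-fan : ∀ e f → index (slotOf e) < k → index (slotOf f) < k → ideal e ≡ ideal f
  ideal-fan e f e-fan f-fan = cong (if_then 1ℤ / (2 * l) else 1ℤ / l)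
    (trans (dec-true (index (slotOf e) <? k) e-fan) (sym (dec-true (index (slotOf f) <? k) f-fan)))

  core : Subset (suc N)
  core = classSet leaves zero

  hub∈core : zero ∈ core
  hub∈core = ∈-classSet leaves ∈⊤ refl

  core-in : ∀ {v} → toℕ v ≤ k → v ∈ core
  core-in v≤k = ∈-classSet leaves ∈⊤ (leafClass-core v≤k)

  core-in⁻ : ∀ {v} → v ∈ core → toℕ v ≤ k
  core-in⁻ v∈ = leafClass-zero⁻ (proj₂ (∈-classSet⁻ leaves v∈))

  module Core .{{_ : NonZero k}} where

    spokeClass : Fin (suc N) → Fin (suc k)
    spokeClass zero    = zero
    spokeClass (suc v) = [ suc , (λ _ → zero) ]′ (splitAt k v)

    spokeClass-suc⁻ : ∀ {v i} → spokeClass v ≡ suc i → v ≡ suc (i ↑ˡ p)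
    spokeClass-suc⁻ {suc v} eq with splitAt k v in split≡
    spokeClass-suc⁻ {suc v} refl | inj₁ i = cong suc (sym (splitAt⁻¹-↑ˡ split≡))

    spokeClass-zero⁻ : ∀ {v} → toℕ v ≤ k → spokeClass v ≡ zero → v ≡ zero
    spokeClass-zero⁻ {zero}  _   _  = refl
    spokeClass-zero⁻ {suc v} v<k eq with splitAt k v in split≡
    ... | inj₂ j = contradiction (≤-trans (m≤m+n k (toℕ j))
                     (≤-reflexive (trans (sym (toℕ-↑ʳ k j)) (cong toℕ (splitAt⁻¹-↑ʳ split≡))))) (<⇒≱ v<k)

    fan-vertex : ∀ i → suc (i ↑ˡ p) ∈ core
    fan-vertex i = core-in (subst (_< k) (sym (toℕ-↑ˡ i p)) (toℕ<n i))

    singles : Partition G core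
    singles = record
      { r         = k
      ; r-nonZero = >-nonZero (>-nonZero⁻¹ k)
      ; class     = spokeClass
      ; inhabited = λ { zero    → zero , hub∈core , refl
                      ; (suc i) → suc (i ↑ˡ p) , fan-vertex i , cong [ suc , (λ _ → zero) ]′ (splitAt-↑ˡ k i p) }
      }

    fan-crosses : ∀ e → Crosses singles e → isFan (slotOf e) ≡ true
    fan-crosses e (u∈ , _) = dec-true (index (slotOf e) <? k)
      (≤-trans (≤-reflexive (sym (toℕ-upper (slotOf e)))) (core-in⁻ u∈))

    fan-crossing : ∣ crossing singles ∣ ≡ (2 * l) * k
    fan-crossing = ≤-antisym (≤-trans (∣crossing∣≤ singles (λ e → ⟦ isFan (slotOf e) ⟧)
        (λ e cr → ≤-reflexive (cong ⟦_⟧ (sym (fan-crosses e cr)))))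
      (≤-reflexive count-fan)) (core-bound singles hub∈core core-in λ k<v v∈ → <⇒≱ k<v (core-in⁻ v∈))
      where
      open ≡-Reasoning
      full-row : ∀ {i} → i < k → l * ⟦ i <ᵇ k ⟧ ≡ l
      full-row {i} i<k = trans (cong (λ b → l * ⟦ b ⟧) (dec-true (i <? k) i<k)) (*-identityʳ l)
      empty-row : ∀ (j : Fin p) → l * ⟦ toℕ (k ↑ʳ j) <ᵇ k ⟧ ≡ 0
      empty-row j = trans (cong (λ b → l * ⟦ b ⟧) (dec-false (toℕ (k ↑ʳ j) <? k)
        (≤⇒≯ (subst (k ≤_) (sym (toℕ-↑ʳ k j)) (m≤m+n k (toℕ j)))))) (*-zeroʳ l)
      count-fan : Σᶠ (λ e → ⟦ isFan (slotOf e) ⟧) ≡ (2 * l) * k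
      count-fan = begin
        _ ≡⟨ Σ-edges (λ s _ → ⟦ isFan s ⟧) ⟩
        Σᶠ {N} (λ v → Σᶠ {l} (λ _ → ⟦ toℕ v <ᵇ k ⟧)) + Σᶠ {k} (λ i → Σᶠ {l} (λ _ → ⟦ toℕ i <ᵇ k ⟧))
          ≡⟨ cong₂ _+_ (trans (sum-cong-≗ {N} (λ v → Σᶠ-const l ⟦ toℕ v <ᵇ k ⟧)) (Σᶠ-↑ k (λ v → l * ⟦ toℕ v <ᵇ k ⟧)))
                       (sum-cong-≗ {k} (λ i → trans (Σᶠ-const l ⟦ toℕ i <ᵇ k ⟧) (full-row (toℕ<n i)))) ⟩
        Σᶠ {k} (λ i → l * ⟦ toℕ (i ↑ˡ p) <ᵇ k ⟧) + Σᶠ {p} (λ j → l * ⟦ toℕ (k ↑ʳ j) <ᵇ k ⟧) + Σᶠ {k} (λ _ → l)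
          ≡⟨ cong₂ _+_ (cong₂ _+_
               (trans (sum-cong-≗ {k} (λ i → full-row (subst (_< k) (sym (toℕ-↑ˡ i p)) (toℕ<n i)))) (Σᶠ-const k l))
               (Σᶠ-zero {p} empty-row)) (Σᶠ-const k l) ⟩
        k * l + 0 + k * l ≡⟨ cong (_+ k * l) (+-identityʳ (k * l)) ⟩
        k * l + k * l     ≡⟨ cong₂ _+_ (*-comm k l) (*-comm k l) ⟩
        l * k + l * k     ≡⟨ trans (*-assoc 2 l k) (cong (λ x → l * k + x) (+-identityʳ (l * k))) ⟨
        (2 * l) * k       ∎

    core-ideal : IdealOn G ideal core
    core-ideal = split singles (value-min singles (2 * l) fan-crossing
        λ P → core-bound P hub∈core core-in λ k<v v∈ → <⇒≱ k<v (core-in⁻ v∈))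
      {{nz}}
      (λ e cr → trans (cong (if_then 1ℤ / (2 * l) else 1ℤ / l) (fan-crosses e cr)) (1/fromℕ {{nz}} (2 * l) value≡2l))
      λ { zero    → single (singleton-size zero (∈-classSet singles hub∈core refl)
                      λ y∈ → let y∈core , eq = ∈-classSet⁻ singles y∈ in spokeClass-zero⁻ (core-in⁻ y∈core) eq)
        ; (suc i) → single (singleton-size (suc (i ↑ˡ p)) (∈-classSet singles (fan-vertex i) (cong [ suc , (λ _ → zero) ]′ (splitAt-↑ˡ k i p)))
                      λ y∈ → spokeClass-suc⁻ (proj₂ (∈-classSet⁻ singles y∈))) }
      where
      value≡2l : value singles ≡ fromℕ (2 * l)
      value≡2l = value≡ singles (2 * l) fan-crossing
      nz : ℚ.NonZero (value singles)
      nz = fromℕ-nonZero (2 * l) value≡2l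

  isIdeal : IsIdealLoad G ideal
  isIdeal = split leaves (value-min leaves l leaf-crossing full-bound)
    {{nz}}
    (λ e cr → trans (cong (if_then 1ℤ / (2 * l) else 1ℤ / l) (not-fan (slotOf e) (leaf-crosses e cr))) (1/fromℕ {{nz}} l value≡l))
    λ { zero    → core-part k refl
      ; (suc j) → single (singleton-size (suc (k ↑ʳ j)) (∈-classSet leaves ∈⊤ (leafClass-leaf j))
                    λ y∈ → leafClass-suc⁻ (proj₂ (∈-classSet⁻ leaves y∈))) }
    where
    value≡l : value leaves ≡ fromℕ l
    value≡l = value≡ leaves l leaf-crossing
    nz : ℚ.NonZero (value leaves)
    nz = fromℕ-nonZero l value≡l
    not-fan : ∀ s → isLeafSpoke s ≡ true → isFan s ≡ false
    not-fan (inj₁ v) leaf = dec-false (toℕ v <? k) (≤⇒≯ (does⇒ (k ≤? toℕ v) leaf))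
    -- For `k` = 0 the core is the hub alone and admits no partition into two classes, so the
    -- recursion stops there.
    core-part : ∀ j → j ≡ k → IdealOn G ideal core
    core-part zero    refl = single (singleton-size zero hub∈core λ y∈ → Fin.toℕ-injective (n≤0⇒n≡0 (core-in⁻ y∈)))
    core-part (suc _) refl = Core.core-ideal

-- Deviation bounds with denominators cleared

/-+ : ∀ a c r .{{_ : NonZero r}} → (pos a / r) ℚ.+ (pos c / r) ≡ pos (a + c) / r
/-+ a c (suc r) = ℚ.toℚᵘ-injective (ℚᵘ.≃-trans (ℚ.toℚᵘ-homo-+ (pos a / suc r) (pos c / suc r))
  (ℚᵘ.≃-trans (ℚᵘ.+-cong (toℚᵘ-/ a (suc r)) (toℚᵘ-/ c (suc r)))
    (ℚᵘ.≃-trans (*≡* same) (ℚᵘ.≃-sym (toℚᵘ-/ (a + c) (suc r))))))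
  where
  R = suc r
  same : (pos a ℤ.* pos R ℤ.+ pos c ℤ.* pos R) ℤ.* pos R ≡ pos (a + c) ℤ.* pos (R * R)
  same = begin
    (pos a ℤ.* pos R ℤ.+ pos c ℤ.* pos R) ℤ.* pos R ≡⟨ cong (ℤ._* pos R) (ℤ.*-distribʳ-+ (pos R) (pos a) (pos c)) ⟨
    pos (a + c) ℤ.* pos R ℤ.* pos R             ≡⟨ ℤ.*-assoc (pos (a + c)) (pos R) (pos R) ⟩
    pos (a + c) ℤ.* (pos R ℤ.* pos R)           ≡⟨ cong (pos (a + c) ℤ.*_) (ℤ.pos-* R R) ⟨
    pos (a + c) ℤ.* pos (R * R)               ∎
    where open ≡-Reasoning

p≤∣p∣ : ∀ p → p ℚ.≤ ℚ.∣ p ∣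
p≤∣p∣ (mkℚ (pos n) _ _)    = ℚ.≤-refl
p≤∣p∣ (mkℚ -[1+ n ] _ _) = ℚ.*≤* ℤ.-≤+

∣p-q∣≤d⇒p≤d+q : ∀ p q {d} → ℚ.∣ p ℚ.- q ∣ ℚ.≤ d → p ℚ.≤ d ℚ.+ q
∣p-q∣≤d⇒p≤d+q p q {d} ≤d = begin
  p                    ≡⟨ ℚS.solve 2 (λ p q → p ℚS.:= (p ℚS.:- q) ℚS.:+ q) refl p q ⟩
  (p ℚ.- q) ℚ.+ q      ≤⟨ ℚ.+-monoˡ-≤ q (ℚ.≤-trans (p≤∣p∣ (p ℚ.- q)) ≤d) ⟩
  d ℚ.+ q              ∎
  where open ℚ.≤-Reasoning

∣p-q∣≤d⇒q≤d+p : ∀ p q {d} → ℚ.∣ p ℚ.- q ∣ ℚ.≤ d → q ℚ.≤ d ℚ.+ p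
∣p-q∣≤d⇒q≤d+p p q {d} ≤d = ∣p-q∣≤d⇒p≤d+q q p (subst (ℚ._≤ d)
  (trans (sym (ℚ.∣-p∣≡∣p∣ (p ℚ.- q))) (cong ℚ.∣_∣ (ℚS.solve 2 (λ p q → ℚS.:- (p ℚS.:- q) ℚS.:= q ℚS.:- p) refl p q))) ≤d)

/-expandʳ : ∀ a r s .{{_ : NonZero r}} .{{_ : NonZero s}} .{{_ : NonZero (r * s)}} →
            pos a / r ≡ pos (a * s) / (r * s)
/-expandʳ a r s = /-≡ a (a * s) r (r * s)
  (trans (cong (a *_) (*-comm r s)) (sym (*-assoc a s r)))

/-expandˡ : ∀ a r s .{{_ : NonZero r}} .{{_ : NonZero s}} .{{_ : NonZero (s * r)}} →
            pos a / r ≡ pos (s * a) / (s * r)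
/-expandˡ a r s = /-≡ a (s * a) r (s * r)
  (solve 3 (λ a r s → a :* (s :* r) := s :* a :* r) refl a r s)

/-cancel-≤ : ∀ a c r .{{_ : NonZero r}} → pos a / r ℚ.≤ pos c / r → a ≤ c
/-cancel-≤ a c r le = *-cancelʳ-≤ a c r (/-≤⁻ a c r r le)

-- For ε = a / b, the load X of a leaf edge and the loads X, Y of two fan edges.
module Deviation (a b′ τ′ l′ : ℕ) where
  b = suc b′
  τ = suc τ′
  l = suc l′

  δ : ℚ
  δ = (pos a / b) ℚ.* (1ℤ / l)

  δ≡ : δ ≡ pos (τ * a) / (τ * (b * l))
  δ≡ = trans (/-* a 1 b l) (trans (cong (λ x → pos x / (b * l)) (*-identityʳ a)) (/-expandˡ a (b * l) τ))

  leaf-deviation : ∀ X → ℚ.∣ (pos X / τ) ℚ.- (1ℤ / l) ∣ ℚ.≤ δ → X * (b * l) ≤ τ * a + τ * b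
  leaf-deviation X near = /-cancel-≤ _ _ (τ * (b * l)) (subst₂ ℚ._≤_ (/-expandʳ X τ (b * l))
    (trans (cong₂ ℚ._+_ δ≡ (/-≡ 1 (τ * b) l (τ * (b * l)) (solve 3 (λ t b l → con 1 :* (t :* (b :* l)) := t :* b :* l) refl τ b l)))
           (/-+ (τ * a) (τ * b) (τ * (b * l))))
    (∣p-q∣≤d⇒p≤d+q (pos X / τ) (1ℤ / l) near))

  -- The common ideal load cancels, so two fan edges are compared directly at the price of twice the
  -- permitted deviation.
  fan-deviation : ∀ X Y ℓ → ℚ.∣ (pos X / τ) ℚ.- ℓ ∣ ℚ.≤ δ → ℚ.∣ (pos Y / τ) ℚ.- ℓ ∣ ℚ.≤ δ →
                  X * (b * l) ≤ τ * a + (τ * a + Y * (b * l))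
  fan-deviation X Y ℓ near-X near-Y = /-cancel-≤ _ _ (τ * (b * l)) (subst₂ ℚ._≤_ (/-expandʳ X τ (b * l))
    (trans (cong₂ (λ d y → d ℚ.+ (d ℚ.+ y)) δ≡ (/-expandʳ Y τ (b * l)))
      (trans (cong ((pos (τ * a) / (τ * (b * l))) ℚ.+_) (/-+ (τ * a) (Y * (b * l)) (τ * (b * l))))
             (/-+ (τ * a) (τ * a + Y * (b * l)) (τ * (b * l)))))
    (ℚ.≤-trans (∣p-q∣≤d⇒p≤d+q (pos X / τ) ℓ near-X)
      (ℚ.+-monoʳ-≤ δ (∣p-q∣≤d⇒q≤d+p (pos Y / τ) ℓ near-Y))))

square-/ : ∀ a r → square (pos a / suc r) ≡ pos (a * a) / (suc r * suc r)
square-/ a r = /-* a a (suc r) (suc r)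

cube-/ : ∀ a r → cube (pos a / suc r) ≡ pos (a * a * a) / (suc r * suc r * suc r)
cube-/ a r = trans (cong (ℚ._* (pos a / suc r)) (square-/ a r)) (/-* (a * a) a (suc r * suc r) (suc r))

atLeast : ∀ M′ l a b′ τ → let M = suc M′ ; b = suc b′ in
          l * l * (b * b * b) ≤ τ * τ * (a * a * a) * (M * M) →
          AtLeastOverThreeHalves (1ℤ / M) l (pos a / b) τ
atLeast M′ l a b′ τ le = subst₂ ℚ._≤_ (sym lhs) (sym rhs)
  (/-≤ (1 * l * (1 * l)) (τ * τ * (a * a * a)) (M * 1 * (M * 1)) (1 * 1 * (b * b * b)) (begin
    1 * l * (1 * l) * (1 * 1 * (b * b * b))
      ≡⟨ solve 2 (λ l b → con 1 :* l :* (con 1 :* l) :* (con 1 :* con 1 :* (b :* b :* b)) := l :* l :* (b :* b :* b)) refl l b ⟩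
    l * l * (b * b * b)
      ≤⟨ le ⟩
    τ * τ * (a * a * a) * (M * M)
      ≡⟨ solve 3 (λ t a m → t :* t :* (a :* a :* a) :* (m :* m) := t :* t :* (a :* a :* a) :* (m :* con 1 :* (m :* con 1))) refl τ a M ⟩
    τ * τ * (a * a * a) * (M * 1 * (M * 1)) ∎))
  where
  open ≤-Reasoning
  M = suc M′
  b = suc b′
  lhs : square ((1ℤ / M) ℚ.* fromℕ l) ≡ pos (1 * l * (1 * l)) / (M * 1 * (M * 1))
  lhs = trans (cong square (/-* 1 l M 1)) (square-/ (1 * l) (M′ * 1))
  rhs : square (fromℕ τ) ℚ.* cube (pos a / b) ≡ pos (τ * τ * (a * a * a)) / (1 * 1 * (b * b * b))
  rhs = trans (cong₂ ℚ._*_ (square-/ τ 0) (cube-/ a b′)) (/-* (τ * τ) (a * a * a) (1 * 1) (b * b * b))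

-- Choice of the parameters

positive-fraction : ∀ ε → 0ℚ ℚ.< ε → ∃[ a ] ∃[ b ] ε ≡ pos (suc a) / suc b
positive-fraction (mkℚ (pos (suc a)) b c) _ = a , b , sym (ℚ.↥p/↧p≡p (mkℚ (pos (suc a)) b c))
positive-fraction (mkℚ (pos zero) _ _)  0<ε with () ← ℚ.positive 0<ε
positive-fraction (mkℚ -[1+ _ ] _ _)  0<ε with () ← ℚ.positive 0<ε

numerator⁺ : ℚ → ℕ
numerator⁺ (mkℚ (pos x) _ _)    = x
numerator⁺ (mkℚ -[1+ _ ] _ _) = 0

cube-mono : ∀ {x y} → x ≤ y → x * x * x ≤ y * y * y
cube-mono x≤y = *-mono-≤ (*-mono-≤ x≤y x≤y) x≤y

-- Replaces `K` by a positive natural number above it, one more than its numerator. A negative `K`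
-- contradicts the hypothesis, because the cube is then not positive.
root-bound : ∀ K a b′ n → InverseAtMostCubeRoot K (pos a / suc b′) n →
             let b = suc b′ ; z = suc (numerator⁺ K) * a in b * b * b ≤ z * z * z * n
root-bound K@(mkℚ (pos x) d c) a b′ n root = begin
  b * b * b                 ≤⟨ cube-mono (m≤m+n b (d * b)) ⟩
  D * D * D                 ≡⟨ solve 1 (λ d → d := con 1 :* (d :* con 1)) refl (D * D * D) ⟩
  1 * (D * D * D * 1)       ≤⟨ /-≤⁻ 1 (X * X * X * n) 1 (D * D * D * 1) (ℚ.≤-trans root (ℚ.≤-reflexive evaluate)) ⟩
  X * X * X * n * 1         ≡⟨ *-identityʳ (X * X * X * n) ⟩
  X * X * X * n             ≤⟨ *-monoˡ-≤ n (cube-mono (m≤n+m X a)) ⟩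
  z * z * z * n             ∎
  where
  open ≤-Reasoning
  b = suc b′
  D = suc d * b
  X = x * a
  z = suc x * a
  evaluate : cube (K ℚ.* (pos a / b)) ℚ.* fromℕ n ≡ pos (X * X * X * n) / (D * D * D * 1)
  evaluate = trans (cong (λ y → cube y ℚ.* fromℕ n)
      (trans (cong (ℚ._* (pos a / b)) (sym (ℚ.↥p/↧p≡p K))) (/-* x a (suc d) b)))
    (trans (cong (ℚ._* fromℕ n) (cube-/ X (b′ + d * b))) (/-* (X * X * X) n (D * D * D) 1))
root-bound (mkℚ -[1+ x ] d c) a b′ n root =
  contradiction (/-≤⁻ 1 0 1 1 (ℚ.≤-trans root (ℚ.≤-trans (ℚ.≤-reflexive negate) (ℚ.neg-antimono-≤ nonneg)))) λ ()
  where
  K′ = mkℚ (pos (suc x)) d c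
  e = pos a / suc b′
  D = suc d * suc b′
  X = suc x * a
  negate : cube (ℚ.- K′ ℚ.* e) ℚ.* fromℕ n ≡ ℚ.- (cube (K′ ℚ.* e) ℚ.* fromℕ n)
  negate = ℚS.solve 3 (λ k e n → ((ℚS.:- k) ℚS.:* e) ℚS.:* ((ℚS.:- k) ℚS.:* e) ℚS.:* ((ℚS.:- k) ℚS.:* e) ℚS.:* n ℚS.:=
    ℚS.:- (k ℚS.:* e ℚS.:* (k ℚS.:* e) ℚS.:* (k ℚS.:* e) ℚS.:* n)) refl K′ e (fromℕ n)
  nonneg : 0ℚ ℚ.≤ cube (K′ ℚ.* e) ℚ.* fromℕ n
  nonneg = ℚ.≤-trans (/-≤ 0 (X * X * X * n) 1 (D * D * D * 1) z≤n) (ℚ.≤-reflexive (sym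
    (trans (cong (λ y → cube y ℚ.* fromℕ n)
        (trans (cong (ℚ._* e) (sym (ℚ.↥p/↧p≡p K′))) (/-* (suc x) a (suc d) (suc b′))))
      (trans (cong (ℚ._* fromℕ n) (cube-/ X (b′ + d * suc b′))) (/-* (X * X * X) n (D * D * D) 1)))))

last-true : ∀ {P : ℕ → Set} → Decidable P → ∀ d k → P k → ¬ P (d + k) →
            ∃[ j ] k ≤ j × P j × ¬ P (suc j)
last-true P? zero    k pk ¬pk = contradiction pk ¬pk
last-true {P} P? (suc d) k pk ¬pd with P? (suc k)
... | no  ¬p = k , ≤-refl , pk , ¬p
... | yes p  with last-true P? d (suc k) p (subst (¬_ ∘ P) (sym (+-suc d k)) ¬pd)
...   | j , k<j , pj , ¬psj = j , <⇒≤ k<j , pj , ¬psj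

-- The constant of the theorem is 1 / M with M = (1 + E)².
module Constants (E : ℕ) where
  M′ M : ℕ
  M′ = E + E * suc E
  M = suc M′

  -- Here ε is at least 1 / `E`. A leaf edge of positive load forces τ to be at least `l` / (1 + ε),
  -- hence of order `l`; its square contributes (1 + `E`)², which is why `M` has this form.
  coarse : ∀ {a b τ l X} → 1 ≤ X → b ≤ E * a → X * (b * l) ≤ τ * a + τ * b →
           l * l * (b * b * b) ≤ τ * τ * (a * a * a) * (M * M)
  coarse {a} {b} {τ} {l} {X} 1≤X b≤ le = begin
    l * l * (b * b * b)
      ≡⟨ solve 2 (λ l b → l :* l :* (b :* b :* b) := b :* l :* (b :* l) :* b) refl l b ⟩
    b * l * (b * l) * b
      ≤⟨ *-mono-≤ (*-mono-≤ bl≤ bl≤) (≤-trans b≤ (*-monoˡ-≤ a E≤M)) ⟩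
    τ * a * suc E * (τ * a * suc E) * (M * a)
      ≡⟨ solve 4 (λ t a e m → t :* a :* e :* (t :* a :* e) :* (m :* a) := t :* t :* (a :* a :* a) :* (e :* e :* m)) refl τ a (suc E) M ⟩
    τ * τ * (a * a * a) * (M * M) ∎
    where
    open ≤-Reasoning
    E≤M : E ≤ M
    E≤M = m≤n⇒m≤1+n (m≤m+n E (E * suc E))
    bl≤ : b * l ≤ τ * a * suc E
    bl≤ = begin
      b * l                  ≡⟨ *-identityˡ (b * l) ⟨
      1 * (b * l)            ≤⟨ *-monoˡ-≤ (b * l) 1≤X ⟩
      X * (b * l)            ≤⟨ le ⟩
      τ * a + τ * b          ≤⟨ +-monoʳ-≤ (τ * a) (*-monoʳ-≤ τ b≤) ⟩
      τ * a + τ * (E * a)    ≡⟨ solve 3 (λ t a e → t :* a :+ t :* (e :* a) := t :* a :* (con 1 :+ e)) refl τ a E ⟩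
      τ * a * suc E          ∎

  -- The first bound says that `t` is at least of order ε^(-1/2), the second that τ is at least `t`
  -- `l` / (4 ε). Eliminating `t` leaves the constant 72 · 4², which `M * M` absorbs.
  fine : ∀ {a b τ l t} → 32 ≤ E → b ≤ 72 * (t * t) * a → t * (b * l) ≤ 4 * (τ * a) →
         l * l * (b * b * b) ≤ τ * τ * (a * a * a) * (M * M)
  fine {a} {b} {τ} {l} {t} 32≤E b≤ le = scaled 72 4 (≤-trans (*-mono-≤ 72≤M 16≤M) ≤-refl) b≤ le
    where
    open ≤-Reasoning
    33≤ : 33 ≤ suc E
    33≤ = s≤s 32≤E
    16≤M : 16 ≤ M
    16≤M = ≤-trans (≤ᵇ⇒≤ 16 33 _) (≤-trans 33≤ (m≤m*n (suc E) (suc E)))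
    72≤M : 72 ≤ M
    72≤M = ≤-trans (≤ᵇ⇒≤ 72 (3 * 33) _) (*-mono-≤ (≤-trans (≤ᵇ⇒≤ 3 33 _) 33≤) 33≤)
    scaled : ∀ u v → u * (v * v) ≤ M * M → b ≤ u * (t * t) * a → t * (b * l) ≤ v * (τ * a) →
             l * l * (b * b * b) ≤ τ * τ * (a * a * a) * (M * M)
    scaled u v uv≤ b≤ le = begin
      l * l * (b * b * b)
        ≡⟨ solve 2 (λ l b → l :* l :* (b :* b :* b) := b :* l :* (b :* l) :* b) refl l b ⟩
      b * l * (b * l) * b
        ≤⟨ *-monoʳ-≤ (b * l * (b * l)) b≤ ⟩
      b * l * (b * l) * (u * (t * t) * a)
        ≡⟨ solve 4 (λ u x t a → x :* x :* (u :* (t :* t) :* a) := u :* a :* (t :* x :* (t :* x))) refl u (b * l) t a ⟩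
      u * a * (t * (b * l) * (t * (b * l)))
        ≤⟨ *-monoʳ-≤ (u * a) (*-mono-≤ le le) ⟩
      u * a * (v * (τ * a) * (v * (τ * a)))
        ≡⟨ solve 4 (λ u v t a → u :* a :* (v :* (t :* a) :* (v :* (t :* a))) := t :* t :* (a :* a :* a) :* (u :* (v :* v))) refl u v τ a ⟩
      τ * τ * (a * a * a) * (u * (v * v))
        ≤⟨ *-monoʳ-≤ (τ * τ * (a * a * a)) uv≤ ⟩
      τ * τ * (a * a * a) * (M * M) ∎

-- Here the relation between ε and n enters: hub, `k` fan vertices and one leaf must fit. If n were
-- at most `k` + 1, the crude bound by 32 · 8 `k`² would split κ³ a³ n into three factors, each at
-- most `b` and one strictly smaller.
room : ∀ {κ a b k n} .{{_ : NonZero κ}} → 2 ≤ k → 32 * (κ * κ * κ) * a < b → 8 * (k * k) * a < b →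
       b * b * b ≤ κ * a * (κ * a) * (κ * a) * n → suc (suc k) ≤ n
room {κ} {a} {b} {k} {n} 2≤k Ea<b ka<b root = ≮⇒≥ λ n<k+2 → <⇒≱ (small (≤-pred n<k+2)) root
  where
  open ≤-Reasoning
  E = 32 * (κ * κ * κ)
  instance
    E≢0 : NonZero E
    E≢0 = m*n≢0 32 (κ * κ * κ) {{_}} {{m*n≢0 (κ * κ) κ {{m*n≢0 κ κ}}}}
    b≢0 : NonZero b
    b≢0 = >-nonZero (≤-trans (s≤s z≤n) Ea<b)
  k+1≤ : suc k ≤ 32 * (8 * (k * k))
  k+1≤ = begin
    suc k                 ≤⟨ +-monoˡ-≤ k (≤-trans (s≤s z≤n) 2≤k) ⟩
    k + k                 ≡⟨ cong (λ x → k + x) (+-identityʳ k) ⟨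
    2 * k                 ≤⟨ *-monoˡ-≤ k 2≤k ⟩
    k * k                 ≤⟨ m≤n*m (k * k) 8 ⟩
    8 * (k * k)           ≤⟨ m≤n*m (8 * (k * k)) 32 ⟩
    32 * (8 * (k * k))    ∎
  a≤b : a ≤ b
  a≤b = ≤-trans (m≤n*m a E) (<⇒≤ Ea<b)
  small : n ≤ suc k → κ * a * (κ * a) * (κ * a) * n < b * b * b
  small n≤ = begin-strict
    κ * a * (κ * a) * (κ * a) * n
      ≤⟨ *-monoʳ-≤ (κ * a * (κ * a) * (κ * a)) (≤-trans n≤ k+1≤) ⟩
    κ * a * (κ * a) * (κ * a) * (32 * (8 * (k * k)))
      ≡⟨ solve 4 (λ c d a k → c :* a :* (c :* a) :* (c :* a) :* (d :* k) :=
                            d :* (c :* c :* c) :* a :* (k :* a) :* a) refl κ 32 a (8 * (k * k)) ⟩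
    E * a * (8 * (k * k) * a) * a
      ≤⟨ *-mono-≤ (*-monoʳ-≤ (E * a) (<⇒≤ ka<b)) a≤b ⟩
    E * a * b * b
      <⟨ *-monoˡ-< b (*-monoˡ-< b Ea<b) ⟩
    b * b * b ∎

-- The second alternative would give `b` ≤ 8 `k`² `a`: a factor 2 from the drift, 2 from halving
-- totals and 2 from comparing two deviations. The choice of `k` excludes this, so the gap is at
-- least `t`.
spread-bound : ∀ {a b l t k τ Q r x y} .{{_ : NonZero Q}} .{{_ : NonZero l}} →
  r ≤ k * k → τ ≤ Q * l → 8 * (k * k) * a < b →
  x * (b * l) ≤ τ * a + (τ * a + y * (b * l)) →
  (t + 2 * y ≤ 2 * x) ⊎ (Q + 2 * r * (2 * y) ≤ 2 * r * (2 * x)) →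
  t * (b * l) ≤ 4 * (τ * a)
spread-bound {a} {b} {l} {t} {k} {τ} {Q} {r} {x} {y} r≤ τ≤ small close = conclude
  where
  open ≤-Reasoning
  B = b * l
  close₂ : 2 * x * B ≤ 4 * (τ * a) + 2 * y * B
  close₂ = begin
    2 * x * B                           ≡⟨ *-assoc 2 x B ⟩
    2 * (x * B)                         ≤⟨ *-monoʳ-≤ 2 close ⟩
    2 * (τ * a + (τ * a + y * B))       ≡⟨ solve 2 (λ d z → con 2 :* (d :+ (d :+ z)) := con 4 :* d :+ con 2 :* z) refl (τ * a) (y * B) ⟩
    4 * (τ * a) + 2 * (y * B)           ≡⟨ cong (λ z → 4 * (τ * a) + z) (*-assoc 2 y B) ⟨
    4 * (τ * a) + 2 * y * B             ∎
  conclude : (t + 2 * y ≤ 2 * x) ⊎ (Q + 2 * r * (2 * y) ≤ 2 * r * (2 * x)) → t * B ≤ 4 * (τ * a)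
  conclude (inj₁ gap) = +-cancelʳ-≤ (2 * y * B) _ _ (begin
    t * B + 2 * y * B       ≡⟨ *-distribʳ-+ B t (2 * y) ⟨
    (t + 2 * y) * B         ≤⟨ *-monoˡ-≤ B gap ⟩
    2 * x * B               ≤⟨ close₂ ⟩
    4 * (τ * a) + 2 * y * B ∎)
  conclude (inj₂ gap) = contradiction b≤ (<⇒≱ small)
    where
    QB≤ : Q * B ≤ 2 * r * (4 * (τ * a))
    QB≤ = +-cancelʳ-≤ (2 * r * (2 * y * B)) _ _ (begin
      Q * B + 2 * r * (2 * y * B)     ≡⟨ solve 4 (λ q r f b → q :* b :+ r :* (f :* b) := (q :+ r :* f) :* b) refl Q (2 * r) (2 * y) B ⟩
      (Q + 2 * r * (2 * y)) * B       ≤⟨ *-monoˡ-≤ B gap ⟩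
      2 * r * (2 * x) * B             ≡⟨ *-assoc (2 * r) (2 * x) B ⟩
      2 * r * (2 * x * B)             ≤⟨ *-monoʳ-≤ (2 * r) close₂ ⟩
      2 * r * (4 * (τ * a) + 2 * y * B) ≡⟨ *-distribˡ-+ (2 * r) (4 * (τ * a)) (2 * y * B) ⟩
      2 * r * (4 * (τ * a)) + 2 * r * (2 * y * B) ∎)
    instance
      Ql≢0 : NonZero (Q * l)
      Ql≢0 = m*n≢0 Q l
    b≤ : b ≤ 8 * (k * k) * a
    b≤ = *-cancelʳ-≤ b (8 * (k * k) * a) (Q * l) (begin
      b * (Q * l)                     ≡⟨ solve 3 (λ b q l → b :* (q :* l) := q :* (b :* l)) refl b Q l ⟩
      Q * B                           ≤⟨ QB≤ ⟩
      2 * r * (4 * (τ * a))           ≤⟨ *-mono-≤ (*-monoʳ-≤ 2 r≤) (*-monoʳ-≤ 4 (*-monoˡ-≤ a τ≤)) ⟩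
      2 * (k * k) * (4 * (Q * l * a)) ≡⟨ solve 5 (λ u v k q a → u :* k :* (v :* (q :* a)) := u :* v :* k :* a :* q) refl 2 4 (k * k) (Q * l) a ⟩
      8 * (k * k) * a * (Q * l)       ∎)

-- Assembly of the two cases

Witness : ℚ → ℚ → (n λ₀ : ℕ) .{{_ : NonZero λ₀}} → Set
Witness c ε n λ₀ =
  Σ[ G ∈ MultiGraph n ] IsMinCutValue G λ₀ ×
    (Σ[ ℓ* ∈ (Fin (MultiGraph.m G) → ℚ) ] IsIdealLoad G ℓ* ×
      (Σ[ T ∈ (ℕ → Subset (MultiGraph.m G)) ]
        (∀ τ → IsGreedy G (firstTrees T τ)) ×
        (∀ τ .{{_ : NonZero τ}} →
          ApproximatesWithin G (ε ℚ.* (1ℤ / λ₀)) (firstTrees T τ) ℓ* →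
          AtLeastOverThreeHalves c λ₀ ε τ)))

module Witnesses (E a b′ l′ : ℕ) where
  open Constants E
  b l : ℕ
  b = suc b′
  l = suc l′

  -- A fan with no fan vertices, that is, a star with parallel edges.
  coarse-witness : ∀ p′ → b ≤ E * a → Witness (1ℤ / M) (pos a / b) (suc (suc p′)) l
  coarse-witness p′ b≤ = G , minCut , ideal , isIdeal , packing , greedy , slow
    where
    open Fan 0 p′ l′ using (G; edge)
    open Packing 0 p′ l′
    open Ideal 0 p′ l′
    leafEdge = edge leafSlot firstCopy
    slow : ∀ τ .{{_ : NonZero τ}} →
           ApproximatesWithin G ((pos a / b) ℚ.* (1ℤ / l)) (firstTrees packing τ) ideal →
           AtLeastOverThreeHalves (1ℤ / M) l (pos a / b) τ
    slow (suc τ′) near = atLeast M′ l a b′ (suc τ′) (coarse {a} {b} {suc τ′} {l} (leaf-load (suc τ′) (s≤s z≤n)) b≤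
      (Deviation.leaf-deviation a b′ τ′ l′ (load G (firstTrees packing (suc τ′)) leafEdge) (near leafEdge)))

  fine-witness : ∀ t p′ → 32 ≤ E → 1 ≤ t → 8 * (suc t * suc t) * a < b → b ≤ 72 * (t * t) * a →
                 Witness (1ℤ / M) (pos a / b) (suc (suc t + suc p′)) l
  fine-witness t p′ 32≤E 1≤t small b≤ = G , minCut , ideal , isIdeal , packing , greedy , slow
    where
    open Fan (suc t) p′ l′ using (G; slotOf; index; edges)
    open Packing (suc t) p′ l′
    open Ideal (suc t) p′ l′
    open Evolution (suc t) using (ranks; ranks≤)
    k = suc t
    bound : ∀ τ′ → ApproximatesWithin G ((pos a / b) ℚ.* (1ℤ / l)) (firstTrees packing (suc τ′)) ideal →
            t * (b * l) ≤ 4 * (suc τ′ * a)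
    bound τ′ near =
      let Q , 1≤Q , τ≤Ql , e , f , e-fan , f-fan , gap = uneven refl 1≤t (suc τ′) (s≤s z≤n)
      in spread-bound {a} {b} {l} {t} {k} {suc τ′} {Q} {ranks} {L e} {L f} {{>-nonZero 1≤Q}} ranks≤ τ≤Ql small (close e f e-fan f-fan) gap
      where
      L : Fin edges → ℕ
      L = load G (firstTrees packing (suc τ′))
      close : ∀ e f → index (slotOf e) < k → index (slotOf f) < k →
              L e * (b * l) ≤ suc τ′ * a + (suc τ′ * a + L f * (b * l))
      close e f e-fan f-fan = Deviation.fan-deviation a b′ τ′ l′ (L e) (L f) (ideal e) (near e)
        (subst (λ x → ℚ.∣ relativeLoad G (firstTrees packing (suc τ′)) f ℚ.- x ∣ ℚ.≤ (pos a / b) ℚ.* (1ℤ / l))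
          (ideal-fan f e f-fan e-fan) (near f))

    slow : ∀ τ .{{_ : NonZero τ}} →
           ApproximatesWithin G ((pos a / b) ℚ.* (1ℤ / l)) (firstTrees packing τ) ideal →
           AtLeastOverThreeHalves (1ℤ / M) l (pos a / b) τ
    slow (suc τ′) near = atLeast M′ l a b′ (suc τ′) (fine {a} {b} {suc τ′} {l} {t} 32≤E b≤ (bound τ′ near))

-- The factor 32 = 8 · 2² makes `k` = 2 admissible as soon as ε is below the threshold; the cube
-- matches the one in the hypothesis on ε and n.
threshold : ℕ → ℕ
threshold κ′ = let κ = suc κ′ in 32 * (κ * κ * κ)

witness : ∀ κ′ a′ b′ l′ n → 2 ≤ n →
          let a = suc a′ ; b = suc b′ ; κ = suc κ′ in
          b * b * b ≤ κ * a * (κ * a) * (κ * a) * n →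
          Witness (1ℤ / Constants.M (threshold κ′)) (pos a / b) n (suc l′)
witness κ′ a′ b′ l′ n@(suc (suc p′)) (s≤s (s≤s z≤n)) root = choose (suc b′ ≤? threshold κ′ * suc a′)
  where
  E = threshold κ′
  open Constants E
  32≤E : 32 ≤ E
  32≤E = m≤m*n 32 (suc κ′ * suc κ′ * suc κ′)
  open ≤-Reasoning
  a = suc a′
  b = suc b′
  P : ℕ → Set
  P j = 8 * (j * j) * a < b
  P? : Decidable P
  P? j = 8 * (j * j) * a <? b
  ¬P-large : ¬ P (b + 2)
  ¬P-large = ≤⇒≯ (begin
    b                             ≤⟨ m≤m+n b 2 ⟩
    b + 2                         ≤⟨ m≤m*n (b + 2) (b + 2) ⟩
    (b + 2) * (b + 2)             ≤⟨ m≤n*m ((b + 2) * (b + 2)) 8 ⟩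
    8 * ((b + 2) * (b + 2))       ≤⟨ m≤m*n (8 * ((b + 2) * (b + 2))) a ⟩
    8 * ((b + 2) * (b + 2)) * a   ∎)
  -- Maximality of `k` = `t` + 1 bounds `b` by 8 (`t` + 2)² `a`, and `t` + 2 ≤ 3 `t` turns this into
  -- the constant 72.
  largest : E * a < b → ∃[ k ] 2 ≤ k × P k × ¬ P (suc k)
  largest Ea<b = last-true P? b 2 (≤-trans (s≤s (*-monoˡ-≤ a 32≤E)) Ea<b) ¬P-large
  enlarge : E * a < b → (∃[ k ] 2 ≤ k × P k × ¬ P (suc k)) → Witness (1ℤ / M) (pos a / b) n (suc l′)
  enlarge Ea<b (suc t , s≤s 1≤t , pk , ¬psk) =
    subst (λ n → Witness (1ℤ / M) (pos a / b) n (suc l′)) n≡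
      (Witnesses.fine-witness E a b′ l′ t p″ 32≤E 1≤t pk (begin
        b                                   ≤⟨ ≮⇒≥ ¬psk ⟩
        8 * (suc (suc t) * suc (suc t)) * a ≤⟨ *-monoˡ-≤ a (*-monoʳ-≤ 8 (*-mono-≤ t+2≤ t+2≤)) ⟩
        8 * (3 * t * (3 * t)) * a           ≡⟨ solve 2 (λ t a → con 8 :* (con 3 :* t :* (con 3 :* t)) :* a := con 72 :* (t :* t) :* a) refl t a ⟩
        72 * (t * t) * a                    ∎))
    where
    k = suc t
    -- The vertices besides the hub, the fan and the one obligatory leaf become further leaves.
    p″ = n ∸ suc (suc k)
    n≡ : suc (k + suc p″) ≡ n
    n≡ = trans (cong suc (+-suc k p″)) (m+[n∸m]≡n (room {suc κ′} (s≤s 1≤t) Ea<b pk root))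
    t+2≤ : suc (suc t) ≤ 3 * t
    t+2≤ = begin
      2 + t         ≡⟨ +-comm 2 t ⟩
      t + 2         ≤⟨ +-monoʳ-≤ t (*-monoʳ-≤ 2 1≤t) ⟩
      t + 2 * t     ∎
  choose : Dec (b ≤ E * a) → Witness (1ℤ / M) (pos a / b) n (suc l′)
  choose (yes b≤) = Witnesses.coarse-witness E a b′ l′ p′ b≤
  choose (no  b≰) = enlarge (≰⇒> b≰) (largest (≰⇒> b≰))

theorem3 : ∀ (K : ℚ) → Σ[ c ∈ ℚ ] 0ℚ ℚ.< c ×
    (∀ (n λ₀ : ℕ) .{{_ : NonZero λ₀}} (ε : ℚ) →
    2 ≤ n → 0ℚ ℚ.< ε → InverseAtMostCubeRoot K ε n →
    Σ[ G ∈ MultiGraph n ] IsMinCutValue G λ₀ ×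
    (Σ[ ℓ* ∈ (Fin (MultiGraph.m G) → ℚ) ] IsIdealLoad G ℓ* ×
    (Σ[ T ∈ (ℕ → Subset (MultiGraph.m G)) ]
    (∀ τ → IsGreedy G (firstTrees T τ)) ×
    (∀ τ .{{_ : NonZero τ}} →
    ApproximatesWithin G (ε ℚ.* (1ℤ / λ₀)) (firstTrees T τ) ℓ* →
    AtLeastOverThreeHalves c λ₀ ε τ))))
theorem3 K = 1ℤ / Constants.M (threshold κ′) , ℚ.positive⁻¹ _ {{ℚ.normalize-pos 1 (Constants.M (threshold κ′))}} , build
  where
  κ′ = numerator⁺ K
  build : ∀ (n λ₀ : ℕ) .{{_ : NonZero λ₀}} (ε : ℚ) → 2 ≤ n → 0ℚ ℚ.< ε → InverseAtMostCubeRoot K ε n →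
          Witness (1ℤ / Constants.M (threshold κ′)) ε n λ₀
  build n (suc l′) ε 2≤n 0<ε = scale (positive-fraction ε 0<ε)
    where
    scale : ∃[ a ] ∃[ b ] ε ≡ pos (suc a) / suc b → InverseAtMostCubeRoot K ε n →
            Witness (1ℤ / Constants.M (threshold κ′)) ε n (suc l′)
    scale (a′ , b′ , refl) root = witness κ′ a′ b′ l′ n 2≤n (root-bound K (suc a′) b′ n root)
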